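{- Let $\Delta=\Gamma\delta\Gamma\subset\mathcal M$ ($\delta\in\mathcal M$) be a double coset. Then every $\xi\in\mathcal A_\Delta$ satisfies $$(1-S)\xi\equiv\alpha\cdot T_\Delta^\infty(1-S)\pmod{(1-T)\mathcal R_\Delta}$$ for a unique number $\alpha=\alpha(\xi)\in\mathbb Q$.
   Context: Let $\Gamma=\mathrm{PSL}_2(\mathbb Z)$, $S=\pm\begin{pmatrix}0&-1\\1&0\end{pmatrix}$, $U=\pm\begin{pmatrix}1&-1\\1&0\end{pmatrix}$, $T=US=\pm\begin{pmatrix}1&1\\0&1\end{pmatrix}$. Let $\mathcal M$ be the set of $2\times2$ integer matrices of positive determinant modulo $\{\pm1\}$, $\mathcal R=\mathbb Q[\mathcal M]$ the $\mathbb Q$-algebra of formal finite linear combinations with multiplication extending matrix multiplication ($1$ = identity). Put $\pi_S=(1+S)/2$, $\pi_U=(1+U+U^2)/3$, $\mathcal I=\pi_S\mathcal R+\pi_U\mathcal R$, $\mathcal A=\{\xi\in\mathcal R:\xi\pi_S\in\mathcal I,\ \xi\pi_U\in\mathcal I\}$. For a double coset $\Delta$ let $\mathcal R_\Delta=\mathbb Q[\Delta]$ and $\mathcal A_\Delta=\mathcal A\cap\mathcal R_\Delta$. Let $T_\Delta^\infty=\sum_{M\in\mathcal M^\infty_\Delta}M$, where $\mathcal M_\Delta^\infty\subset\Delta$ is a set of representatives of $\Gamma\backslash\Delta$ consisting of matrices fixing $\infty$ (lower-left entry $0$). Congruence modulo $(1-T)\mathcal R_\Delta$ means the difference lies in $(1-T)\mathcal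 R_\Delta$. -}

module Defs where

open import Data.Bool using (if_then_else_)
open import Data.Integer as ℤ using (ℤ; +_; -[1+_])
open import Data.Rational as ℚ using (ℚ; 0ℚ; 1ℚ)
open import Data.List using (List; []; _∷_; _++_; map; concatMap; length; lookup)
open import Data.List.Relation.Unary.All using (All)
open import Data.Fin using (Fin)
open import Data.Product using (Σ; ∃; ∃₂; _×_; _,_)
open import Data.Sum using (_⊎_)
open import Relation.Nullary using (¬_; Dec; does; yes; no)
open import Relation.Nullary.Decidable using (_⊎-dec_)
open import Relation.Binary.PropositionalEquality using (_≡_; _≢_; refl; cong; cong₂)

record Mat : Set where
  constructor mat
  field
    a b c d : ℤ

_·_ : Mat → Mat → Mat
infixl 8 _·_
mat a b c d · mat a' b' c' d' =
  mat (a ℤ.* a' ℤ.+ b ℤ.* c') (a ℤ.* b' ℤ.+ b ℤ.* d')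
      (c ℤ.* a' ℤ.+ d ℤ.* c') (c ℤ.* b' ℤ.+ d ℤ.* d')

det : Mat → ℤ
det (mat a b c d) = a ℤ.* d ℤ.- b ℤ.* c

negM : Mat → Mat
negM (mat a b c d) = mat (ℤ.- a) (ℤ.- b) (ℤ.- c) (ℤ.- d)

_≟M_ : (M N : Mat) → Dec (M ≡ N)
mat a b c d ≟M mat a' b' c' d' with a ℤ.≟ a' | b ℤ.≟ b' | c ℤ.≟ c' | d ℤ.≟ d'
... | yes refl | yes refl | yes refl | yes refl = yes refl
... | no p | _ | _ | _ = no λ { refl → p refl }
... | yes _ | no p | _ | _ = no λ { refl → p refl }
... | yes _ | yes _ | no p | _ = no λ { refl → p refl }
... | yes _ | yes _ | yes _ | no p = no λ { refl → p refl }

_~_ : Mat → Mat → Set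
M ~ N = M ≡ N ⊎ M ≡ negM N

_~?_ : (M N : Mat) → Dec (M ~ N)
M ~? N = (M ≟M N) ⊎-dec (M ≟M negM N)

I₂ Sm Um Tm : Mat
I₂ = mat (+ 1) (+ 0) (+ 0) (+ 1)
Sm = mat (+ 0) (ℤ.- + 1) (+ 1) (+ 0)
Um = mat (+ 1) (ℤ.- + 1) (+ 1) (+ 0)
Tm = mat (+ 1) (+ 1) (+ 0) (+ 1)

-- Γ = PSL₂(ℤ): matrices of determinant 1 (taken modulo ±1 via _~_)
InΓ : Mat → Set
InΓ g = det g ≡ + 1

-- Formal finite ℚ-linear combinations of matrices (representatives);
-- the element of ℚ[𝓜] they denote is given by the coefficient function.
R : Set
R = List (ℚ × Mat)

coeff : R → Mat → ℚ
coeff [] M = 0ℚ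
coeff ((q , N) ∷ ξ) M = if does (N ~? M) then q ℚ.+ coeff ξ M else coeff ξ M

_≈_ : R → R → Set
ξ ≈ η = ∀ M → coeff ξ M ≡ coeff η M

InR : R → Set
InR ξ = ∀ M → coeff ξ M ≢ 0ℚ → + 0 ℤ.< det M

[_] : Mat → R
[ M ] = (1ℚ , M) ∷ []

one : R
one = [ I₂ ]

_⊕_ : R → R → R
_⊕_ = _++_

_⊙_ : ℚ → R → R
q ⊙ ξ = map (λ { (p , M) → (q ℚ.* p , M) }) ξ

_⊖_ : R → R → R
ξ ⊖ η = ξ ⊕ ((ℚ.- 1ℚ) ⊙ η)

_⊗_ : R → R → R
ξ ⊗ η = concatMap (λ { (p , M) → map (λ { (q , N) → (p ℚ.* q , M · N) }) η }) ξ

infixl 7 _⊗_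
infixr 7 _⊙_
infixl 6 _⊕_ _⊖_

πS : R
πS = ℚ.½ ⊙ (one ⊕ [ Sm ])

πU : R
πU = (+ 1 ℚ./ 3) ⊙ (one ⊕ [ Um ] ⊕ [ Um · Um ])

InI : R → Set
InI ξ = ∃₂ λ η₁ η₂ → InR η₁ × InR η₂ × ξ ≈ (πS ⊗ η₁ ⊕ πU ⊗ η₂)

InA : R → Set
InA ξ = InR ξ × InI (ξ ⊗ πS) × InI (ξ ⊗ πU)

InΔ : Mat → Mat → Set
InΔ δ M = ∃₂ λ g h → InΓ g × InΓ h × M ~ (g · δ · h)

InRΔ : Mat → R → Set
InRΔ δ ξ = ∀ M → coeff ξ M ≢ 0ℚ → InΔ δ M

InAΔ : Mat → R → Set
InAΔ δ ξ = InA ξ × InRΔ δ ξ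

CongModΔ : Mat → R → R → Set
CongModΔ δ x y = ∃ λ η → InRΔ δ η × x ≈ (y ⊕ (one ⊖ [ Tm ]) ⊗ η)

IsInftyReps : Mat → List Mat → Set
IsInftyReps δ L =
  All (λ M → InΔ δ M × Mat.c M ≡ + 0) L
  × (∀ (i j : Fin (length L)) →
       (∃ λ γ → InΓ γ × lookup L i ~ (γ · lookup L j)) → i ≡ j)
  × (∀ M → InΔ δ M → ∃ λ (i : Fin (length L)) → ∃ λ γ → InΓ γ × M ~ (γ · lookup L i))

Tinf : List Mat → R
Tinf L = map (λ M → (1ℚ , M)) L

{-# OPTIONS --safe #-}

-- Put x = (1 − S)ξ and let X(M) be the coefficient of x at the class of M in ℚ[⟨T⟩\Δ].
-- Since (1 − S)𝓘 ⊂ (1 − T)𝓡, the two conditions on ξ give X|(1 + S) = 0 and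
-- X|(1 + U + U²) = 0, hence the three-term relation X(M) = X(MT) + X(MT′) with
-- T′ = (1 0; 1 1).  On matrices with bottom row (c , d), c, d > 0, the right-hand side has
-- larger bottom rows, so finiteness of the support forces X(M) = 0; up to sign and S this
-- covers all M with cd ≠ 0.  For c = 0 the relation then reads X(M) = X(MT), and X is
-- determined by its values on the representatives L: x ≡ V(1 − S) mod (1 − T)𝓡_Δ with
-- V = Σ X(Lⱼ)Lⱼ.  In ℚ[Γ\Δ] both x and (1 − T)𝓡_Δ vanish, so the image of V is invariant
-- under S; it is also invariant under T, hence under Γ, which acts transitively on Γ\Δ.
-- So all X(Lⱼ) equal one number α, which is recovered as the coefficient X(Lⱼ).

module Submission where

open import Defs
open import Data.Bool using (Bool; true; false; not; if_then_else_)
open import Data.Empty using (⊥-elim)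
open import Data.Fin using (zero; suc)
import Data.Fin.Properties as Fin
open import Data.Integer as ℤ using (ℤ; +_; -[1+_])
open import Data.Integer.DivMod using () renaming (_/_ to _/ᶻ_; _%_ to _%ᶻ_; a≡a%n+[a/n]*n to div-eq; n%d<d to mod-<)
open import Data.Integer.Divisibility.Signed using (divides; _∣?_)
import Data.Integer.Properties as ℤ
open import Data.Integer.Tactic.RingSolver using (solve-∀)
open import Data.List using (List; []; _∷_; _++_; map; length; lookup)
open import Data.List.Membership.Propositional.Properties using (∈-lookup)
open import Data.List.Relation.Unary.All as All using (All; []; _∷_)
open import Data.List.Relation.Unary.All.Properties using (++⁺; map⁺)
open import Data.Nat as ℕ using (ℕ; zero; suc; s≤s; z≤n)
import Data.Nat.Properties as ℕ
open import Data.Product using (Σ; ∃; _×_; _,_; proj₁; proj₂)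
open import Data.Rational as ℚ using (ℚ; 0ℚ; 1ℚ)
import Data.Rational.Properties as ℚ
open import Data.Rational.Solver using (module +-*-Solver)
open import Data.Sum using (_⊎_; inj₁; inj₂)
open import Function using (_∘_; mk⇔)
open import Relation.Binary.PropositionalEquality using (_≡_; _≢_; refl; sym; trans; cong; cong₂; subst; module ≡-Reasoning)
open import Relation.Nullary using (¬_; Dec; does; yes; no)
open import Relation.Nullary.Decidable using (does-⇔; dec-true; dec-false; ¬?; _×-dec_; map′)

open +-*-Solver using (solve; _:+_; _:*_; _:-_; :-_; _:=_; con)

-- Linear functionals on ℚ[𝓜]

-- Identities in 𝓡 are tested against functions on matrices: sums and products of lists become sums
-- and nested evaluations of φ, so lists never need a normal form.
pair : (Mat → ℚ) → R → ℚ
pair φ [] = 0ℚ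
pair φ ((q , M) ∷ ξ) = q ℚ.* φ M ℚ.+ pair φ ξ

pair-cong : ∀ {φ ψ} → (∀ M → φ M ≡ ψ M) → ∀ ξ → pair φ ξ ≡ pair ψ ξ
pair-cong h [] = refl
pair-cong h ((q , M) ∷ ξ) = cong₂ (λ x y → q ℚ.* x ℚ.+ y) (h M) (pair-cong h ξ)

pair-++ : ∀ φ ξ η → pair φ (ξ ++ η) ≡ pair φ ξ ℚ.+ pair φ η
pair-++ φ [] η = sym (ℚ.+-identityˡ _)
pair-++ φ ((q , M) ∷ ξ) η = trans (cong (q ℚ.* φ M ℚ.+_) (pair-++ φ ξ η)) (sym (ℚ.+-assoc (q ℚ.* φ M) _ _))

pair-+ : ∀ φ ψ ξ → pair (λ M → φ M ℚ.+ ψ M) ξ ≡ pair φ ξ ℚ.+ pair ψ ξ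
pair-+ φ ψ [] = refl
pair-+ φ ψ ((q , M) ∷ ξ) rewrite pair-+ φ ψ ξ =
  solve 5 (λ q a b c d → q :* (a :+ b) :+ (c :+ d) := (q :* a :+ c) :+ (q :* b :+ d)) refl
    q (φ M) (ψ M) (pair φ ξ) (pair ψ ξ)

pair-* : ∀ r φ ξ → pair (λ M → r ℚ.* φ M) ξ ≡ r ℚ.* pair φ ξ
pair-* r φ [] = sym (ℚ.*-zeroʳ r)
pair-* r φ ((q , M) ∷ ξ) rewrite pair-* r φ ξ =
  solve 4 (λ q r a c → q :* (r :* a) :+ r :* c := r :* (q :* a :+ c)) refl q r (φ M) (pair φ ξ)

pair-zero : ∀ ξ → pair (λ _ → 0ℚ) ξ ≡ 0ℚ
pair-zero [] = refl
pair-zero ((q , M) ∷ ξ) rewrite pair-zero ξ | ℚ.*-zeroʳ q = refl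

pair-⊙ : ∀ φ r ξ → pair φ (r ⊙ ξ) ≡ r ℚ.* pair φ ξ
pair-⊙ φ r [] = sym (ℚ.*-zeroʳ r)
pair-⊙ φ r ((q , M) ∷ ξ) = trans (cong (r ℚ.* q ℚ.* φ M ℚ.+_) (pair-⊙ φ r ξ))
  (solve 4 (λ q r a c → (r :* q) :* a :+ r :* c := r :* (q :* a :+ c)) refl q r (φ M) (pair φ ξ))

pair-⊖ : ∀ φ ξ η → pair φ (ξ ⊖ η) ≡ pair φ ξ ℚ.- pair φ η
pair-⊖ φ ξ η = trans (pair-++ φ ξ _) (cong (pair φ ξ ℚ.+_) (trans (pair-⊙ φ (ℚ.- 1ℚ) η)
  (solve 1 (λ x → :- con 1ℚ :* x := :- x) refl (pair φ η))))

-- The map f is a variable known only pointwise, so that it can be unified with the pattern-matching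
-- function inside `_⊗_`.
pair-map : ∀ φ p M (f : ℚ × Mat → ℚ × Mat) → (∀ q N → f (q , N) ≡ (p ℚ.* q , M · N)) →
  ∀ η → pair φ (map f η) ≡ p ℚ.* pair (λ N → φ (M · N)) η
pair-map φ p M f h [] = sym (ℚ.*-zeroʳ p)
pair-map φ p M f h ((q , N) ∷ η) rewrite h q N | pair-map φ p M f h η =
  solve 4 (λ q r a c → (r :* q) :* a :+ r :* c := r :* (q :* a :+ c)) refl q p (φ (M · N)) _

pair-⊗ : ∀ φ ξ η → pair φ (ξ ⊗ η) ≡ pair (λ M → pair (λ N → φ (M · N)) η) ξ
pair-⊗ φ [] η = refl
pair-⊗ φ ((p , M) ∷ ξ) η = trans (pair-++ φ (map _ η) (ξ ⊗ η))
  (cong₂ ℚ._+_ (pair-map φ p M _ (λ _ _ → refl) η) (pair-⊗ φ ξ η))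

pair-one⊖ : ∀ ψ g → pair ψ (one ⊖ [ g ]) ≡ ψ I₂ ℚ.- ψ g
pair-one⊖ ψ g = trans (pair-⊖ ψ one [ g ])
  (solve 2 (λ x y → (con 1ℚ :* x :+ con 0ℚ) :- (con 1ℚ :* y :+ con 0ℚ) := x :- y) refl (ψ I₂) (ψ g))

-- Matrix products and equality up to sign

mat-≡ : ∀ {a b c d a' b' c' d'} → a ≡ a' → b ≡ b' → c ≡ c' → d ≡ d' → mat a b c d ≡ mat a' b' c' d'
mat-≡ refl refl refl refl = refl

·-assoc : ∀ L M N → (L · M) · N ≡ L · (M · N)
·-assoc (mat a b c d) (mat e f g h) (mat i j k l) =
  mat-≡ (e₁ a b e f g h i k) (e₁ a b e f g h j l) (e₁ c d e f g h i k) (e₁ c d e f g h j l)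
  where
  e₁ : ∀ a b e f g h i k → (a ℤ.* e ℤ.+ b ℤ.* g) ℤ.* i ℤ.+ (a ℤ.* f ℤ.+ b ℤ.* h) ℤ.* k
     ≡ a ℤ.* (e ℤ.* i ℤ.+ f ℤ.* k) ℤ.+ b ℤ.* (g ℤ.* i ℤ.+ h ℤ.* k)
  e₁ = solve-∀

·-identityˡ : ∀ M → I₂ · M ≡ M
·-identityˡ (mat a b c d) = mat-≡ (e₁ a c) (e₁ b d) (e₂ a c) (e₂ b d)
  where
  e₁ : ∀ a c → + 1 ℤ.* a ℤ.+ + 0 ℤ.* c ≡ a
  e₁ = solve-∀
  e₂ : ∀ a c → + 0 ℤ.* a ℤ.+ + 1 ℤ.* c ≡ c
  e₂ = solve-∀

·-identityʳ : ∀ M → M · I₂ ≡ M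
·-identityʳ (mat a b c d) = mat-≡ (e₁ a b) (e₂ a b) (e₁ c d) (e₂ c d)
  where
  e₁ : ∀ a c → a ℤ.* + 1 ℤ.+ c ℤ.* + 0 ≡ a
  e₁ = solve-∀
  e₂ : ∀ a c → a ℤ.* + 0 ℤ.+ c ℤ.* + 1 ≡ c
  e₂ = solve-∀

neg-·ˡ : ∀ M N → negM M · N ≡ negM (M · N)
neg-·ˡ (mat a b c d) (mat e f g h) = mat-≡ (e₁ a b e g) (e₁ a b f h) (e₁ c d e g) (e₁ c d f h)
  where
  e₁ : ∀ a b e g → (ℤ.- a) ℤ.* e ℤ.+ (ℤ.- b) ℤ.* g ≡ ℤ.- (a ℤ.* e ℤ.+ b ℤ.* g)
  e₁ = solve-∀

neg-·ʳ : ∀ M N → M · negM N ≡ negM (M · N)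
neg-·ʳ (mat a b c d) (mat e f g h) = mat-≡ (e₁ a b e g) (e₁ a b f h) (e₁ c d e g) (e₁ c d f h)
  where
  e₁ : ∀ a b e g → a ℤ.* (ℤ.- e) ℤ.+ b ℤ.* (ℤ.- g) ≡ ℤ.- (a ℤ.* e ℤ.+ b ℤ.* g)
  e₁ = solve-∀

neg-neg : ∀ M → negM (negM M) ≡ M
neg-neg (mat a b c d) = mat-≡ (ℤ.neg-involutive a) (ℤ.neg-involutive b) (ℤ.neg-involutive c) (ℤ.neg-involutive d)

~-refl : ∀ {M} → M ~ M
~-refl = inj₁ refl

~-sym : ∀ {M N} → M ~ N → N ~ M
~-sym (inj₁ e) = inj₁ (sym e)
~-sym {M} {N} (inj₂ refl) = inj₂ (sym (neg-neg N))

~-trans : ∀ {L M N} → L ~ M → M ~ N → L ~ N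
~-trans (inj₁ refl) q = q
~-trans (inj₂ refl) (inj₁ refl) = inj₂ refl
~-trans (inj₂ refl) (inj₂ refl) = inj₁ (neg-neg _)

-- These are the functions that descend to 𝓜, where M and -M are the same element.
Even : (Mat → ℚ) → Set
Even φ = ∀ M → φ (negM M) ≡ φ M

even-~ : ∀ {φ} → Even φ → ∀ {M N} → M ~ N → φ M ≡ φ N
even-~ ev (inj₁ refl) = refl
even-~ ev (inj₂ refl) = ev _

even-·ˡ : ∀ {φ} → Even φ → ∀ g → Even (λ N → φ (g · N))
even-·ˡ {φ} ev g N = trans (cong φ (neg-·ʳ g N)) (ev _)

ind : Bool → ℚ
ind b = if b then 1ℚ else 0ℚ

δ[_] : Mat → Mat → ℚ
δ[ N ] M = ind (does (M ~? N))

coeff-pair : ∀ ξ N → coeff ξ N ≡ pair δ[ N ] ξ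
coeff-pair [] N = refl
coeff-pair ((q , M) ∷ ξ) N with does (M ~? N)
... | true = cong₂ ℚ._+_ (sym (ℚ.*-identityʳ q)) (coeff-pair ξ N)
... | false = trans (coeff-pair ξ N) (trans (sym (ℚ.+-identityˡ _)) (cong (ℚ._+ _) (sym (ℚ.*-zeroʳ q))))

~?-congˡ : ∀ {M M′} → M ~ M′ → ∀ N → does (M ~? N) ≡ does (M′ ~? N)
~?-congˡ {M} {M′} e N = does-⇔ (mk⇔ (~-trans (~-sym e)) (~-trans e)) (M ~? N) (M′ ~? N)

even-δ : ∀ N → Even δ[ N ]
even-δ N M = cong ind (~?-congˡ {negM M} {M} (inj₂ refl) N)

-- Splitting a combination along a set of matrices

restrict : (Mat → Bool) → R → R
restrict t [] = []
restrict t ((q , M) ∷ ξ) = if t M then (q , M) ∷ restrict t ξ else restrict t ξ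

length-restrict : ∀ t ξ → length (restrict t ξ) ℕ.≤ length ξ
length-restrict t [] = z≤n
length-restrict t ((q , M) ∷ ξ) with t M
... | true = s≤s (length-restrict t ξ)
... | false = ℕ.m≤n⇒m≤1+n (length-restrict t ξ)

restrict-All : ∀ {P : ℚ × Mat → Set} t ξ → All P ξ → All P (restrict t ξ)
restrict-All t [] [] = []
restrict-All t ((q , M) ∷ ξ) (p ∷ ps) with t M
... | true = p ∷ restrict-All t ξ ps
... | false = restrict-All t ξ ps

restrict-holds : ∀ t ξ → All (λ e → t (proj₂ e) ≡ true) (restrict t ξ)
restrict-holds t [] = []
restrict-holds t ((q , M) ∷ ξ) with t M in eq
... | true = eq ∷ restrict-holds t ξ
... | false = restrict-holds t ξ

pair-restrict : ∀ φ t ξ → pair φ (restrict t ξ) ≡ pair (λ M → if t M then φ M else 0ℚ) ξ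
pair-restrict φ t [] = refl
pair-restrict φ t ((q , M) ∷ ξ) with t M
... | true = cong (q ℚ.* φ M ℚ.+_) (pair-restrict φ t ξ)
... | false = trans (pair-restrict φ t ξ) (trans (sym (ℚ.+-identityˡ _)) (cong (ℚ._+ _) (sym (ℚ.*-zeroʳ q))))

pair-split : ∀ φ t ξ → pair φ ξ ≡ pair φ (restrict t ξ) ℚ.+ pair φ (restrict (not ∘ t) ξ)
pair-split φ t ξ = begin
  pair φ ξ ≡⟨ pair-cong (λ M → pt (t M) (φ M)) ξ ⟩
  pair (λ M → (if t M then φ M else 0ℚ) ℚ.+ (if not (t M) then φ M else 0ℚ)) ξ ≡⟨ pair-+ _ _ ξ ⟩
  _ ≡⟨ cong₂ ℚ._+_ (pair-restrict φ t ξ) (pair-restrict φ (not ∘ t) ξ) ⟨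
  _ ∎
  where
  open ≡-Reasoning
  pt : ∀ b x → x ≡ (if b then x else 0ℚ) ℚ.+ (if not b then x else 0ℚ)
  pt true x = sym (ℚ.+-identityʳ x)
  pt false x = sym (ℚ.+-identityˡ x)

pair-class : ∀ φ t M → (∀ N → t N ≡ true → φ N ≡ φ M) → ∀ ξ →
  pair φ (restrict t ξ) ≡ pair (ind ∘ t) ξ ℚ.* φ M
pair-class φ t M h ξ = begin
  pair φ (restrict t ξ) ≡⟨ pair-restrict φ t ξ ⟩
  pair (λ N → if t N then φ N else 0ℚ) ξ ≡⟨ pair-cong pt ξ ⟩
  pair (λ N → φ M ℚ.* ind (t N)) ξ ≡⟨ pair-* (φ M) (ind ∘ t) ξ ⟩
  φ M ℚ.* pair (ind ∘ t) ξ ≡⟨ ℚ.*-comm (φ M) _ ⟩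
  _ ∎
  where
  open ≡-Reasoning
  pt : ∀ N → (if t N then φ N else 0ℚ) ≡ φ M ℚ.* ind (t N)
  pt N with t N in eq
  ... | true = trans (h N eq) (sym (ℚ.*-identityʳ _))
  ... | false = sym (ℚ.*-zeroʳ (φ M))

does-true : ∀ {P : Set} (p : Dec P) → does p ≡ true → P
does-true (yes p) _ = p

-- A class of total coefficient 0 contributes nothing to a functional that is constant on it.
-- Dropping such a class is the inductive step both for single elements of 𝓜 and for orbits.
pair-remove : ∀ φ t M → (∀ N → t N ≡ true → φ N ≡ φ M) → ∀ ζ → pair (ind ∘ t) ζ ≡ 0ℚ →
  pair φ ζ ≡ pair φ (restrict (not ∘ t) ζ)
pair-remove φ t M h ζ z = begin
  pair φ ζ ≡⟨ pair-split φ t ζ ⟩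
  pair φ (restrict t ζ) ℚ.+ ρ ≡⟨ cong (ℚ._+ ρ) (pair-class φ t M h ζ) ⟩
  pair (ind ∘ t) ζ ℚ.* φ M ℚ.+ ρ ≡⟨ cong (λ x → x ℚ.* φ M ℚ.+ ρ) z ⟩
  0ℚ ℚ.* φ M ℚ.+ ρ ≡⟨ cong (ℚ._+ ρ) (ℚ.*-zeroˡ (φ M)) ⟩
  0ℚ ℚ.+ ρ ≡⟨ ℚ.+-identityˡ ρ ⟩
  ρ ∎
  where
  open ≡-Reasoning
  ρ = pair φ (restrict (not ∘ t) ζ)

length-remove : ∀ t q M ξ → t M ≡ true → length (restrict (not ∘ t) ((q , M) ∷ ξ)) ℕ.≤ length ξ
length-remove t q M ξ tM rewrite tM = length-restrict _ ξ

-- A list denoting 0 may still have entries that cancel. The entries equal to the first one up to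
-- sign have total coefficient 0, so they can be removed together; the list gets shorter and its
-- other coefficients do not change.
null-pair : ∀ {φ} → Even φ → ∀ ζ → (∀ N → pair δ[ N ] ζ ≡ 0ℚ) → pair φ ζ ≡ 0ℚ
null-pair {φ} ev ζ = go (length ζ) ζ ℕ.≤-refl
  where
  go : ∀ n ζ → length ζ ℕ.≤ n → (∀ N → pair δ[ N ] ζ ≡ 0ℚ) → pair φ ζ ≡ 0ℚ
  go _ [] _ _ = refl
  go (suc n) ((q , M) ∷ ξ) (s≤s le) z = trans (rest φ ev)
    (go n (restrict (not ∘ t) ((q , M) ∷ ξ)) (ℕ.≤-trans (length-remove t q M ξ (dec-true (M ~? M) ~-refl)) le)
      λ N → trans (sym (rest δ[ N ] (even-δ N))) (z N))
    where
    t : Mat → Bool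
    t N = does (N ~? M)
    rest : ∀ ψ → Even ψ → pair ψ ((q , M) ∷ ξ) ≡ pair ψ (restrict (not ∘ t) ((q , M) ∷ ξ))
    rest ψ ev′ = pair-remove ψ t M (λ N e → even-~ {ψ} ev′ (does-true (N ~? M) e)) ((q , M) ∷ ξ) (z M)

p-q≡0⇒p≡q : ∀ {p q : ℚ} → p ℚ.- q ≡ 0ℚ → p ≡ q
p-q≡0⇒p≡q {p} {q} e = trans (solve 2 (λ p q → p := (p :- q) :+ q) refl p q) (trans (cong (ℚ._+ q) e) (ℚ.+-identityˡ q))

-- Together with `≈-pair` this makes `_≈_` the same as agreement under all even functionals, the
-- form in which it is used from here on.
pair-≈ : ∀ {φ} → Even φ → ∀ {ξ η} → ξ ≈ η → pair φ ξ ≡ pair φ η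
pair-≈ {φ} ev {ξ} {η} e = p-q≡0⇒p≡q (trans (sym (pair-⊖ φ ξ η)) (null-pair ev (ξ ⊖ η) λ N →
  trans (pair-⊖ δ[ N ] ξ η) (trans (cong₂ ℚ._-_ (trans (sym (coeff-pair ξ N)) (e N)) (sym (coeff-pair η N))) (ℚ.+-inverseʳ (coeff η N)))))

≈-pair : ∀ {ξ η} → (∀ φ → Even φ → pair φ ξ ≡ pair φ η) → ξ ≈ η
≈-pair {ξ} {η} h N = trans (coeff-pair ξ N) (trans (h _ (even-δ N)) (sym (coeff-pair η N)))

coeff-~ : ∀ ξ {M N} → M ~ N → coeff ξ M ≡ coeff ξ N
coeff-~ [] e = refl
coeff-~ ((q , L) ∷ ξ) {M} {N} e rewrite does-⇔ (mk⇔ (λ p → ~-trans p e) (λ p → ~-trans p (~-sym e))) (L ~? M) (L ~? N) | coeff-~ ξ e = refl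

-- `InRΔ` speaks only of nonzero coefficients, so a list may contain cancelling entries outside Δ.
-- Passing to the support gives the same element with every entry in Δ.
support : R → R
support ξ = restrict (λ M → does (¬? (coeff ξ M ℚ.≟ 0ℚ))) ξ

support-All : ∀ ξ → All (λ e → coeff ξ (proj₂ e) ≢ 0ℚ) (support ξ)
support-All ξ = All.map (λ {e} → does-true (¬? (coeff ξ (proj₂ e) ℚ.≟ 0ℚ))) (restrict-holds _ ξ)

pair-support : ∀ {φ} → Even φ → ∀ ξ → pair φ (support ξ) ≡ pair φ ξ
pair-support {φ} ev ξ = sym (trans (pair-split φ t ξ) (trans (cong (pair φ (support ξ) ℚ.+_) (null-pair ev (restrict (not ∘ t) ξ) z)) (ℚ.+-identityʳ _)))
  where
  open ≡-Reasoning
  t : Mat → Bool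
  t M = does (¬? (coeff ξ M ℚ.≟ 0ℚ))
  pt₁ : ∀ {P Q : Set} (p : Dec P) (d : Dec Q) → (P → Q) → (if not (does (¬? d)) then ind (does p) else 0ℚ) ≡ ind (does p)
  pt₁ (yes _) (yes _) _ = refl
  pt₁ (no _) (yes _) _ = refl
  pt₁ (no _) (no _) _ = refl
  pt₁ (yes p) (no ¬q) f = ⊥-elim (¬q (f p))
  pt₂ : ∀ {P Q : Set} (p : Dec P) (d : Dec Q) → (P → ¬ Q) → (if not (does (¬? d)) then ind (does p) else 0ℚ) ≡ 0ℚ
  pt₂ (no _) (yes _) _ = refl
  pt₂ (no _) (no _) _ = refl
  pt₂ (yes _) (no _) _ = refl
  pt₂ (yes p) (yes q) f = ⊥-elim (f p q)
  -- `coeff ξ` is constant on the class of N, so the class is discarded as a whole, with total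
  -- coefficient 0, or kept as a whole, leaving an empty sum here.
  z : ∀ N → pair δ[ N ] (restrict (not ∘ t) ξ) ≡ 0ℚ
  z N with coeff ξ N ℚ.≟ 0ℚ
  ... | yes c≡0 = begin
      _ ≡⟨ pair-restrict δ[ N ] (not ∘ t) ξ ⟩
      _ ≡⟨ pair-cong (λ M → pt₁ (M ~? N) (coeff ξ M ℚ.≟ 0ℚ) (λ p → trans (coeff-~ ξ p) c≡0)) ξ ⟩
      pair δ[ N ] ξ ≡⟨ coeff-pair ξ N ⟨
      coeff ξ N ≡⟨ c≡0 ⟩
      0ℚ ∎
  ... | no c≢0 = begin
      _ ≡⟨ pair-restrict δ[ N ] (not ∘ t) ξ ⟩
      _ ≡⟨ pair-cong (λ M → pt₂ (M ~? N) (coeff ξ M ℚ.≟ 0ℚ) (λ p z → c≢0 (trans (sym (coeff-~ ξ p)) z))) ξ ⟩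
      _ ≡⟨ pair-zero ξ ⟩
      0ℚ ∎

-- Determinants and adjugates

-- On Γ this is the inverse; in general it is the inverse times the determinant, and stays integral.
adj : Mat → Mat
adj (mat a b c d) = mat d (ℤ.- b) (ℤ.- c) a

det-· : ∀ M N → det (M · N) ≡ det M ℤ.* det N
det-· (mat a b c d) (mat e f g h) = e₁ a b c d e f g h
  where
  e₁ : ∀ a b c d e f g h →
    (a ℤ.* e ℤ.+ b ℤ.* g) ℤ.* (c ℤ.* f ℤ.+ d ℤ.* h) ℤ.+ ℤ.- ((a ℤ.* f ℤ.+ b ℤ.* h) ℤ.* (c ℤ.* e ℤ.+ d ℤ.* g))
    ≡ (a ℤ.* d ℤ.+ ℤ.- (b ℤ.* c)) ℤ.* (e ℤ.* h ℤ.+ ℤ.- (f ℤ.* g))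
  e₁ = solve-∀

det-adj : ∀ M → det (adj M) ≡ det M
det-adj (mat a b c d) = e₁ a b c d
  where
  e₁ : ∀ a b c d → d ℤ.* a ℤ.+ ℤ.- (ℤ.- b ℤ.* (ℤ.- c)) ≡ a ℤ.* d ℤ.+ ℤ.- (b ℤ.* c)
  e₁ = solve-∀

det-neg : ∀ M → det (negM M) ≡ det M
det-neg (mat a b c d) = e₁ a b c d
  where
  e₁ : ∀ a b c d → ℤ.- a ℤ.* (ℤ.- d) ℤ.+ ℤ.- (ℤ.- b ℤ.* (ℤ.- c)) ≡ a ℤ.* d ℤ.+ ℤ.- (b ℤ.* c)
  e₁ = solve-∀

mapM : (ℤ → ℤ) → Mat → Mat
mapM f (mat a b c d) = mat (f a) (f b) (f c) (f d)

·-adj : ∀ γ M → γ · M · adj M ≡ mapM (ℤ._* det M) γ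
·-adj (mat p q r s) (mat a b c d) = mat-≡ (e₁ p q a b c d) (e₂ p q a b c d) (e₁ r s a b c d) (e₂ r s a b c d)
  where
  e₁ : ∀ p q a b c d → (p ℤ.* a ℤ.+ q ℤ.* c) ℤ.* d ℤ.+ (p ℤ.* b ℤ.+ q ℤ.* d) ℤ.* (ℤ.- c)
    ≡ p ℤ.* (a ℤ.* d ℤ.+ ℤ.- (b ℤ.* c))
  e₁ = solve-∀
  e₂ : ∀ p q a b c d → (p ℤ.* a ℤ.+ q ℤ.* c) ℤ.* (ℤ.- b) ℤ.+ (p ℤ.* b ℤ.+ q ℤ.* d) ℤ.* a
    ≡ q ℤ.* (a ℤ.* d ℤ.+ ℤ.- (b ℤ.* c))
  e₂ = solve-∀

adj-adj : ∀ M → adj (adj M) ≡ M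
adj-adj (mat a b c d) = mat-≡ refl (ℤ.neg-involutive b) (ℤ.neg-involutive c) refl

det-I·ˡ : ∀ {g} M → InΓ g → det (g · M) ≡ det M
det-I·ˡ {g} M e = trans (det-· g M) (trans (cong (ℤ._* det M) e) (ℤ.*-identityˡ _))

det-I·ʳ : ∀ {g} M → InΓ g → det (M · g) ≡ det M
det-I·ʳ {g} M e = trans (det-· M g) (trans (cong (det M ℤ.*_) e) (ℤ.*-identityʳ _))

·-cancelʳ : ∀ N {h} → InΓ h → N · h · adj h ≡ N
·-cancelʳ N@(mat a b c d) {h} e = trans (·-adj N h) (mat-≡ (z a) (z b) (z c) (z d))
  where
  z : ∀ x → x ℤ.* det h ≡ x
  z x = trans (cong (x ℤ.*_) e) (ℤ.*-identityʳ x)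

InΓ-adj : ∀ {g} → InΓ g → InΓ (adj g)
InΓ-adj {g} e = trans (det-adj g) e

·-cancelʳ′ : ∀ N {h} → InΓ h → N · adj h · h ≡ N
·-cancelʳ′ N {h} e = subst (λ k → N · adj h · k ≡ N) (adj-adj h) (·-cancelʳ N (InΓ-adj {h} e))

adj-inverseˡ : ∀ {g} → InΓ g → adj g · g ≡ I₂
adj-inverseˡ {g} e = trans (cong (_· g) (sym (·-identityˡ (adj g)))) (·-cancelʳ′ I₂ {g} e)

·-cancelˡ : ∀ {g} N → InΓ g → adj g · (g · N) ≡ N
·-cancelˡ {g} N e = trans (sym (·-assoc (adj g) g N)) (trans (cong (_· N) (adj-inverseˡ {g} e)) (·-identityˡ N))

InΓ-· : ∀ {g h} → InΓ g → InΓ h → InΓ (g · h)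
InΓ-· {g} {h} e f = trans (det-I·ˡ {g} h e) f

InΓ-neg : ∀ {g} → InΓ g → InΓ (negM g)
InΓ-neg {g} e = trans (det-neg g) e

-- Orbits of subgroups of Γ

-- Membership is a predicate on matrices; closure under negation makes it the preimage of a subgroup
-- of PSL₂(ℤ). Decidability is what makes orbit indicators computable.
record Subgroup : Set₁ where
  field
    K : Mat → Set
    K? : ∀ g → Dec (K g)
    K⊆Γ : ∀ {g} → K g → InΓ g
    K-I : K I₂
    K-neg : ∀ {g} → K g → K (negM g)
    K-· : ∀ {g h} → K g → K h → K (g · h)
    K-adj : ∀ {g} → K g → K (adj g)

quo : ℤ → ℤ → ℤ
quo d x with d ∣? x
... | yes (divides q _) = q
-- An arbitrary value: `Cand` compares N with the candidate times M, so a false quotient is never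
-- accepted.
... | no _ = + 0

quo-* : ∀ d x → d ≢ + 0 → quo d (x ℤ.* d) ≡ x
quo-* d x d≢0 with d ∣? (x ℤ.* d)
... | yes (divides q e) = ℤ.*-cancelʳ-≡ q x d {{ℤ.≢-nonZero d≢0}} (sym e)
... | no ¬d = ⊥-elim (¬d (divides x refl))

module Orbits (G : Subgroup) where
  open Subgroup G

  Orb : Mat → Mat → Set
  Orb M N = ∃ λ γ → K γ × N ≡ γ · M

  -- N = γ M determines γ as N adj(M) / det M.
  candidate : Mat → Mat → Mat
  candidate M N = mapM (quo (det M)) (N · adj M)

  Cand : Mat → Mat → Set
  Cand M N = K (candidate M N) × N ≡ candidate M N · M

  cand? : ∀ M N → Dec (Cand M N)
  cand? M N = K? (candidate M N) ×-dec (N ≟M (candidate M N · M))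

  orb? : ∀ M N → det M ≢ + 0 → Dec (Orb M N)
  orb? M N ne = map′ (λ { (k , e) → candidate M N , k , e }) complete (cand? M N)
    where
    complete : Orb M N → Cand M N
    complete (γ , k , refl) = subst K (sym e) k , cong (_· M) (sym e)
      where
      e : candidate M (γ · M) ≡ γ
      e = trans (cong (mapM (quo (det M))) (·-adj γ M))
        (mat-≡ (quo-* (det M) (Mat.a γ) ne) (quo-* (det M) (Mat.b γ) ne) (quo-* (det M) (Mat.c γ) ne) (quo-* (det M) (Mat.d γ) ne))

  opaque
    -- Sealed: from here on only the facts proved in this block are used, never the division inside
    -- the candidate.
    test : Mat → Mat → Bool
    test M N = does (cand? M N)

    test-sound : ∀ M N → test M N ≡ true → Orb M N
    test-sound M N e with does-true (cand? M N) e
    ... | k , p = candidate M N , k , p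

    test-in : ∀ {M N} → det M ≢ + 0 → Orb M N → test M N ≡ true
    test-in {M} {N} ne o = dec-true (orb? M N ne) o

    test-out : ∀ {M N} → ¬ Orb M N → test M N ≡ false
    test-out {M} {N} ¬o = dec-false (cand? M N) λ { (k , e) → ¬o (candidate M N , k , e) }

    test-cong : ∀ {M N M′ N′} → det M ≢ + 0 → det M′ ≢ + 0 → (Orb M N → Orb M′ N′) → (Orb M′ N′ → Orb M N) →
      test M N ≡ test M′ N′
    test-cong {M} {N} {M′} {N′} ne ne′ f g = does-⇔ (mk⇔ f g) (orb? M N ne) (orb? M′ N′ ne′)

  -- Pairing with `χ M` reads off the coefficient at the class of M in the quotient of ℚ[𝓜] by the
  -- left action of the subgroup.
  χ : Mat → Mat → ℚ
  χ M N = ind (test M N)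

  χ-in : ∀ {M N} → det M ≢ + 0 → Orb M N → χ M N ≡ 1ℚ
  χ-in {M} {N} ne o = cong ind (test-in {M} {N} ne o)

  χ-out : ∀ {M N} → ¬ Orb M N → χ M N ≡ 0ℚ
  χ-out {M} {N} ¬o = cong ind (test-out {M} {N} ¬o)

  orb-refl : ∀ M → Orb M M
  orb-refl M = I₂ , K-I , sym (·-identityˡ M)

  orb-sym : ∀ {M N} → Orb M N → Orb N M
  orb-sym {M} (γ , k , refl) = adj γ , K-adj k , sym (·-cancelˡ {γ} M (K⊆Γ k))

  orb-trans : ∀ {L M N} → Orb L M → Orb M N → Orb L N
  orb-trans {L} (γ , k , refl) (γ′ , k′ , refl) = γ′ · γ , K-· k′ k , sym (·-assoc γ′ γ L)

  orb-neg : ∀ M → Orb M (negM M)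
  orb-neg M = negM I₂ , K-neg K-I , sym (trans (neg-·ˡ I₂ M) (cong negM (·-identityˡ M)))

  orb-det : ∀ {M N} → Orb M N → det N ≡ det M
  orb-det {M} (γ , k , refl) = det-I·ˡ {γ} M (K⊆Γ k)

  orb-·ʳ : ∀ {M N} h → Orb M N → Orb (M · h) (N · h)
  orb-·ʳ {M} h (γ , k , refl) = γ , k , ·-assoc γ M h

  χ-congˡ : ∀ {M M′} → det M ≢ + 0 → Orb M M′ → ∀ N → χ M N ≡ χ M′ N
  χ-congˡ {M} {M′} ne o N = cong ind (test-cong {M} {N} {M′} {N} ne (ne ∘ trans (sym (orb-det {M} {M′} o))) (orb-trans {M′} {M} {N} (orb-sym {M} {M′} o)) (orb-trans {M} {M′} {N} o))

  χ-congʳ : ∀ {M N N′} → det M ≢ + 0 → Orb N N′ → χ M N ≡ χ M N′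
  χ-congʳ {M} {N} {N′} ne o = cong ind (test-cong {M} {N} {M} {N′} ne ne (λ p → orb-trans {M} {N} {N′} p o) (λ p → orb-trans {M} {N′} {N} p (orb-sym {N} {N′} o)))

  χ-even : ∀ {M} → det M ≢ + 0 → Even (χ M)
  χ-even {M} ne N = sym (χ-congʳ {M} {N} {negM N} ne (orb-neg N))

  -- Right translation permutes the left orbits: Nh lies in the orbit of M exactly when N lies in
  -- that of Mh⁻¹.
  χ-·ʳ : ∀ {M h} N → det M ≢ + 0 → InΓ h → χ M (N · h) ≡ χ (M · adj h) N
  χ-·ʳ {M} {h} N ne e = cong ind (test-cong {M} {N · h} {M · adj h} {N} ne (ne ∘ trans (sym (det-I·ʳ {adj h} M (InΓ-adj {h} e))))
    (λ o → subst (Orb (M · adj h)) (·-cancelʳ N {h} e) (orb-·ʳ {M} {N · h} (adj h) o))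
    (λ o → subst (λ L → Orb L (N · h)) (·-cancelʳ′ M {h} e) (orb-·ʳ {M · adj h} {N} h o)))

Γ : Subgroup
Γ = record
  { K = InΓ
  ; K? = λ g → det g ℤ.≟ + 1
  ; K⊆Γ = λ e → e
  ; K-I = refl
  ; K-neg = λ {g} → InΓ-neg {g}
  ; K-· = λ {g} {h} → InΓ-· {g} {h}
  ; K-adj = λ {g} → InΓ-adj {g}
  }

c-· : ∀ {g h} → Mat.c g ≡ + 0 → Mat.c h ≡ + 0 → Mat.c (g · h) ≡ + 0
c-· {mat a b _ d} {mat e f _ h} refl refl = e₁ d e
  where
  e₁ : ∀ d e → + 0 ℤ.* e ℤ.+ d ℤ.* + 0 ≡ + 0
  e₁ = solve-∀

-- The stabiliser of ∞ in Γ, i.e. ± the group generated by T.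
Γ∞ : Subgroup
Γ∞ = record
  { K = λ g → InΓ g × Mat.c g ≡ + 0
  ; K? = λ g → (det g ℤ.≟ + 1) ×-dec (Mat.c g ℤ.≟ + 0)
  ; K⊆Γ = proj₁
  ; K-I = refl , refl
  ; K-neg = λ {g} → λ (e , z) → InΓ-neg {g} e , cong ℤ.-_ z
  ; K-· = λ {g} {h} → λ (e , z) (e′ , z′) → InΓ-· {g} {h} e e′ , c-· {g} {h} z z′
  ; K-adj = λ {g} → λ (e , z) → InΓ-adj {g} e , cong ℤ.-_ z
  }

-- The three-term relation

pair-neg : ∀ φ ξ → pair (λ M → ℚ.- φ M) ξ ≡ ℚ.- pair φ ξ
pair-neg φ ξ = trans (pair-cong (λ M → sym (solve 1 (λ x → :- con 1ℚ :* x := :- x) refl (φ M))) ξ)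
  (trans (pair-* (ℚ.- 1ℚ) φ ξ) (solve 1 (λ x → :- con 1ℚ :* x := :- x) refl (pair φ ξ)))

pair-- : ∀ φ ψ ξ → pair (λ M → φ M ℚ.- ψ M) ξ ≡ pair φ ξ ℚ.- pair ψ ξ
pair-- φ ψ ξ = trans (pair-+ φ _ ξ) (cong (pair φ ξ ℚ.+_) (pair-neg ψ ξ))

pair-1- : ∀ φ g ξ → pair φ ((one ⊖ [ g ]) ⊗ ξ) ≡ pair (λ N → φ N ℚ.- φ (g · N)) ξ
pair-1- φ g ξ = begin
  pair φ ((one ⊖ [ g ]) ⊗ ξ) ≡⟨ pair-⊗ φ (one ⊖ [ g ]) ξ ⟩
  _ ≡⟨ pair-one⊖ (λ M → pair (λ N → φ (M · N)) ξ) g ⟩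
  pair (λ N → φ (I₂ · N)) ξ ℚ.- pair (λ N → φ (g · N)) ξ
    ≡⟨ cong (λ y → y ℚ.- pair (λ N → φ (g · N)) ξ) (pair-cong (λ N → cong φ (·-identityˡ N)) ξ) ⟩
  pair φ ξ ℚ.- pair (λ N → φ (g · N)) ξ ≡⟨ pair-- φ _ ξ ⟨
  _ ∎
  where open ≡-Reasoning

pair--1 : ∀ φ ξ g → pair φ (ξ ⊗ (one ⊖ [ g ])) ≡ pair φ ξ ℚ.- pair (λ N → φ (N · g)) ξ
pair--1 φ ξ g = begin
  pair φ (ξ ⊗ (one ⊖ [ g ])) ≡⟨ pair-⊗ φ ξ (one ⊖ [ g ]) ⟩
  _ ≡⟨ pair-cong (λ M → trans (pair-one⊖ (λ N → φ (M · N)) g)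
         (cong (λ L → φ L ℚ.- φ (M · g)) (·-identityʳ M))) ξ ⟩
  pair (λ M → φ M ℚ.- φ (M · g)) ξ ≡⟨ pair-- φ _ ξ ⟩
  _ ∎
  where open ≡-Reasoning

⅓ : ℚ
⅓ = + 1 ℚ./ 3

pair-πS : ∀ ψ → pair ψ πS ≡ ℚ.½ ℚ.* (ψ I₂ ℚ.+ ψ Sm)
pair-πS ψ = solve 2 (λ x y → con ℚ.½ :* x :+ (con ℚ.½ :* y :+ con 0ℚ) := con ℚ.½ :* (x :+ y)) refl (ψ I₂) (ψ Sm)

pair-πU : ∀ ψ → pair ψ πU ≡ ⅓ ℚ.* (ψ I₂ ℚ.+ ψ Um ℚ.+ ψ (Um · Um))
pair-πU ψ = solve 3 (λ x y z → con ⅓ :* x :+ (con ⅓ :* y :+ (con ⅓ :* z :+ con 0ℚ)) := con ⅓ :* (x :+ y :+ z)) refl (ψ I₂) (ψ Um) (ψ (Um · Um))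

pair-πS⊗ : ∀ φ η → pair φ (πS ⊗ η) ≡ ℚ.½ ℚ.* pair (λ N → φ N ℚ.+ φ (Sm · N)) η
pair-πS⊗ φ η = begin
  pair φ (πS ⊗ η) ≡⟨ pair-⊗ φ πS η ⟩
  _ ≡⟨ pair-πS (λ M → pair (λ N → φ (M · N)) η) ⟩
  ℚ.½ ℚ.* (pair (λ N → φ (I₂ · N)) η ℚ.+ pair (λ N → φ (Sm · N)) η)
    ≡⟨ cong (λ x → ℚ.½ ℚ.* (x ℚ.+ pair (λ N → φ (Sm · N)) η)) (pair-cong (λ N → cong φ (·-identityˡ N)) η) ⟩
  ℚ.½ ℚ.* (pair φ η ℚ.+ pair (λ N → φ (Sm · N)) η) ≡⟨ cong (ℚ.½ ℚ.*_) (pair-+ φ _ η) ⟨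
  _ ∎
  where open ≡-Reasoning

pair-πU⊗ : ∀ φ η → pair φ (πU ⊗ η) ≡ ⅓ ℚ.* pair (λ N → φ N ℚ.+ φ (Um · N) ℚ.+ φ (Um · Um · N)) η
pair-πU⊗ φ η = begin
  pair φ (πU ⊗ η) ≡⟨ pair-⊗ φ πU η ⟩
  _ ≡⟨ pair-πU (λ M → pair (λ N → φ (M · N)) η) ⟩
  ⅓ ℚ.* (pair (λ N → φ (I₂ · N)) η ℚ.+ A ℚ.+ B)
    ≡⟨ cong (λ x → ⅓ ℚ.* (x ℚ.+ A ℚ.+ B)) (pair-cong (λ N → cong φ (·-identityˡ N)) η) ⟩
  ⅓ ℚ.* (pair φ η ℚ.+ A ℚ.+ B) ≡⟨ cong (λ x → ⅓ ℚ.* (x ℚ.+ B)) (pair-+ φ _ η) ⟨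
  _ ≡⟨ cong (⅓ ℚ.*_) (pair-+ _ _ η) ⟨
  _ ∎
  where
  open ≡-Reasoning
  A = pair (λ N → φ (Um · N)) η
  B = pair (λ N → φ (Um · Um · N)) η

pair-⊗πS : ∀ φ ξ → pair φ (ξ ⊗ πS) ≡ ℚ.½ ℚ.* (pair φ ξ ℚ.+ pair (λ N → φ (N · Sm)) ξ)
pair-⊗πS φ ξ = begin
  pair φ (ξ ⊗ πS) ≡⟨ pair-⊗ φ ξ πS ⟩
  _ ≡⟨ pair-cong (λ M → trans (pair-πS (λ N → φ (M · N))) (cong (λ L → ℚ.½ ℚ.* (φ L ℚ.+ φ (M · Sm))) (·-identityʳ M))) ξ ⟩
  _ ≡⟨ pair-* ℚ.½ _ ξ ⟩
  _ ≡⟨ cong (ℚ.½ ℚ.*_) (pair-+ φ _ ξ) ⟩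
  _ ∎
  where open ≡-Reasoning

pair-⊗πU : ∀ φ ξ → pair φ (ξ ⊗ πU) ≡
  ⅓ ℚ.* (pair φ ξ ℚ.+ pair (λ N → φ (N · Um)) ξ ℚ.+ pair (λ N → φ (N · (Um · Um))) ξ)
pair-⊗πU φ ξ = begin
  pair φ (ξ ⊗ πU) ≡⟨ pair-⊗ φ ξ πU ⟩
  _ ≡⟨ pair-cong (λ M → trans (pair-πU (λ N → φ (M · N)))
         (cong (λ L → ⅓ ℚ.* (φ L ℚ.+ φ (M · Um) ℚ.+ φ (M · (Um · Um)))) (·-identityʳ M))) ξ ⟩
  _ ≡⟨ pair-* ⅓ _ ξ ⟩
  _ ≡⟨ cong (⅓ ℚ.*_) (pair-+ _ _ ξ) ⟩
  _ ≡⟨ cong (λ x → ⅓ ℚ.* (x ℚ.+ pair (λ N → φ (N · (Um · Um))) ξ)) (pair-+ φ _ ξ) ⟩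
  _ ∎
  where open ≡-Reasoning

pair-assoc : ∀ φ ξ η ζ → pair φ ((ξ ⊗ η) ⊗ ζ) ≡ pair φ (ξ ⊗ (η ⊗ ζ))
pair-assoc φ ξ η ζ = begin
  pair φ ((ξ ⊗ η) ⊗ ζ) ≡⟨ pair-⊗ φ (ξ ⊗ η) ζ ⟩
  _ ≡⟨ pair-⊗ _ ξ η ⟩
  _ ≡⟨ pair-cong (λ L → pair-cong (λ M → pair-cong (λ N → cong φ (·-assoc L M N)) ζ) η) ξ ⟩
  _ ≡⟨ pair-cong (λ L → pair-⊗ (λ K → φ (L · K)) η ζ) ξ ⟨
  _ ≡⟨ pair-⊗ φ ξ (η ⊗ ζ) ⟨
  _ ∎
  where open ≡-Reasoning

SS : ∀ N → Sm · (Sm · N) ≡ negM N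
SS N = trans (sym (·-assoc Sm Sm N)) (trans (neg-·ˡ I₂ N) (cong negM (·-identityˡ N)))

TS : ∀ N → Tm · (Sm · N) ≡ Um · N
TS N = sym (·-assoc Tm Sm N)

UUU : ∀ N → Um · (Um · Um · N) ≡ negM N
UUU N = trans (sym (·-assoc Um (Um · Um) N)) (trans (neg-·ˡ I₂ N) (cong negM (·-identityˡ N)))

-- (1 − S)π_S = 0 and (1 − S)π_U = −(1 − T)Sπ_U, as T S = U.
1-S-kills-I : ∀ {φ} → Even φ → (∀ N → φ (Tm · N) ≡ φ N) → ∀ {ζ} → InI ζ → pair φ ((one ⊖ [ Sm ]) ⊗ ζ) ≡ 0ℚ
1-S-kills-I {φ} ev inv {ζ} (η₁ , η₂ , _ , _ , e) = begin
  pair φ ((one ⊖ [ Sm ]) ⊗ ζ) ≡⟨ pair-1- φ Sm ζ ⟩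
  pair ψ ζ ≡⟨ pair-≈ {ψ} evψ {ζ} {πS ⊗ η₁ ⊕ πU ⊗ η₂} e ⟩
  pair ψ (πS ⊗ η₁ ⊕ πU ⊗ η₂) ≡⟨ pair-++ ψ (πS ⊗ η₁) (πU ⊗ η₂) ⟩
  pair ψ (πS ⊗ η₁) ℚ.+ pair ψ (πU ⊗ η₂) ≡⟨ cong₂ ℚ._+_ s u ⟩
  0ℚ ∎
  where
  open ≡-Reasoning
  ψ : Mat → ℚ
  ψ N = φ N ℚ.- φ (Sm · N)
  evψ : Even ψ
  evψ N = cong₂ ℚ._-_ (ev N) (even-·ˡ {φ} ev Sm N)
  s : pair ψ (πS ⊗ η₁) ≡ 0ℚ
  s = trans (pair-πS⊗ ψ η₁) (trans (cong (ℚ.½ ℚ.*_) (trans (pair-cong pt η₁) (pair-zero η₁))) (ℚ.*-zeroʳ ℚ.½))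
    where
    pt : ∀ N → ψ N ℚ.+ ψ (Sm · N) ≡ 0ℚ
    pt N = trans (cong (λ z → ψ N ℚ.+ (φ (Sm · N) ℚ.- z)) (trans (cong φ (SS N)) (ev N)))
      (solve 2 (λ x y → (x :- y) :+ (y :- x) := con 0ℚ) refl (φ N) (φ (Sm · N)))
  u : pair ψ (πU ⊗ η₂) ≡ 0ℚ
  u = trans (pair-πU⊗ ψ η₂) (trans (cong (⅓ ℚ.*_) (trans (pair-cong pt η₂) (pair-zero η₂))) (ℚ.*-zeroʳ ⅓))
    where
    -- Since TS = U, a T-invariant φ takes the same value at SN and UN. So ψ(N) = φ(N) - φ(UN), and
    -- the sum over 1, U, U² telescopes because U³ = -1 and φ is even.
    S→U : ∀ N → φ (Sm · N) ≡ φ (Um · N)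
    S→U N = trans (sym (inv (Sm · N))) (cong φ (TS N))
    telescope : ∀ {p q r p′ q′ r′} → p′ ≡ q → q′ ≡ r → r′ ≡ p → (p ℚ.- p′) ℚ.+ (q ℚ.- q′) ℚ.+ (r ℚ.- r′) ≡ 0ℚ
    telescope {p} {q} {r} refl refl refl = solve 3 (λ x y z → (x :- y) :+ (y :- z) :+ (z :- x) := con 0ℚ) refl p q r
    pt : ∀ N → ψ N ℚ.+ ψ (Um · N) ℚ.+ ψ (Um · Um · N) ≡ 0ℚ
    pt N = telescope {φ N} {φ (Um · N)} {φ (Um · Um · N)} (S→U N)
      (trans (S→U (Um · N)) (cong φ (sym (·-assoc Um Um N))))
      (trans (S→U (Um · Um · N)) (trans (cong φ (UUU N)) (ev N)))

½-cancel : ∀ x → ℚ.½ ℚ.* x ≡ 0ℚ → x ≡ 0ℚ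
½-cancel x e = trans (solve 1 (λ x → x := (con 1ℚ :+ con 1ℚ) :* (con ℚ.½ :* x)) refl x) (trans (cong ((1ℚ ℚ.+ 1ℚ) ℚ.*_) e) (ℚ.*-zeroʳ (1ℚ ℚ.+ 1ℚ)))

⅓-cancel : ∀ x → ⅓ ℚ.* x ≡ 0ℚ → x ≡ 0ℚ
⅓-cancel x e = trans (solve 1 (λ x → x := (con 1ℚ :+ con 1ℚ :+ con 1ℚ) :* (con ⅓ :* x)) refl x) (trans (cong ((1ℚ ℚ.+ 1ℚ ℚ.+ 1ℚ) ℚ.*_) e) (ℚ.*-zeroʳ (1ℚ ℚ.+ 1ℚ ℚ.+ 1ℚ)))

T′m : Mat
T′m = mat (+ 1) (+ 0) (+ 1) (+ 1)

module O∞ = Orbits Γ∞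
open O∞ using (χ)

χ-T : ∀ M → det M ≢ + 0 → ∀ N → χ M (Tm · N) ≡ χ M N
χ-T M ne N = sym (O∞.χ-congʳ {M} {N} {Tm · N} ne (Tm , (refl , refl) , refl))

nz-·ʳ : ∀ {M h} → det M ≢ + 0 → InΓ h → det (M · h) ≢ + 0
nz-·ʳ {M} {h} ne e = ne ∘ trans (sym (det-I·ʳ {h} M e))

module Cocycle (ξ : R) (IS : InI (ξ ⊗ πS)) (IU : InI (ξ ⊗ πU)) where
  x : R
  x = (one ⊖ [ Sm ]) ⊗ ξ

  -- The coefficient of (1 − S)ξ at the class of M in ℚ[⟨T⟩\𝓜].
  X : Mat → ℚ
  X M = pair (χ M) x

  X-orb : ∀ {M M′} → det M ≢ + 0 → O∞.Orb M M′ → X M ≡ X M′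
  X-orb {M} {M′} ne o = pair-cong (O∞.χ-congˡ {M} {M′} ne o) x

  X-neg : ∀ M → det M ≢ + 0 → X (negM M) ≡ X M
  X-neg M ne = sym (X-orb {M} ne (O∞.orb-neg M))

  X-·ʳ : ∀ M {h} → det M ≢ + 0 → InΓ h → pair (λ N → χ M (N · h)) x ≡ X (M · adj h)
  X-·ʳ M {h} ne e = pair-cong (λ N → O∞.χ-·ʳ {M} {h} N ne e) x

  -- (1 - S)ξπ_S lies in (1 - S)𝓘, which every even T-invariant functional kills; `χ M` is one.
  -- Clearing the factor ½ gives the relation. `X-U` is the same argument with π_U.
  X-S : ∀ M → det M ≢ + 0 → X M ≡ ℚ.- X (M · adj Sm)
  X-S M ne = p-q≡0⇒p≡q (trans (solve 2 (λ a b → a :- (:- b) := a :+ b) refl (X M) (X (M · adj Sm)))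
    (½-cancel _ (trans (cong (λ y → ℚ.½ ℚ.* (X M ℚ.+ y)) (sym (X-·ʳ M {Sm} ne refl)))
    (trans (sym (pair-⊗πS (χ M) x))
    (trans (pair-assoc (χ M) (one ⊖ [ Sm ]) ξ πS) (1-S-kills-I (O∞.χ-even {M} ne) (χ-T M ne) {ξ ⊗ πS} IS))))))

  X-U : ∀ M → det M ≢ + 0 → X M ℚ.+ X (M · adj Um) ℚ.+ X (M · adj (Um · Um)) ≡ 0ℚ
  X-U M ne = ⅓-cancel _ (trans (cong₂ (λ y z → ⅓ ℚ.* (X M ℚ.+ y ℚ.+ z)) (sym (X-·ʳ M {Um} ne refl)) (sym (X-·ʳ M {Um · Um} ne refl)))
    (trans (sym (pair-⊗πU (χ M) x))
    (trans (pair-assoc (χ M) (one ⊖ [ Sm ]) ξ πU) (1-S-kills-I (O∞.χ-even {M} ne) (χ-T M ne) {ξ ⊗ πU} IU))))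

  -- In `X-U`, the relation `X-S` turns -X(MU⁻¹) and -X(MU⁻²) into X(MU⁻¹S⁻¹) and X(MU⁻²S⁻¹); up to
  -- sign U⁻¹S⁻¹ = T′ and U⁻²S⁻¹ = T.
  X-three-term : ∀ M → det M ≢ + 0 → X M ≡ X (M · Tm) ℚ.+ X (M · T′m)
  X-three-term M ne = trans (solve 3 (λ p q r → p := (p :+ q :+ r) :+ ((:- r) :+ (:- q))) refl (X M) (X (M · adj Um)) (X (M · adj (Um · Um))))
    (trans (cong₂ ℚ._+_ (X-U M ne) (cong₂ ℚ._+_ (eq (Um · Um) Tm refl refl refl) (eq Um T′m refl refl refl))) (ℚ.+-identityˡ _))
    where
    open ≡-Reasoning
    eq : ∀ h t → InΓ h → InΓ t → adj h · adj Sm ≡ negM t → ℚ.- X (M · adj h) ≡ X (M · t)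
    eq h t e f p = begin
      ℚ.- X (M · adj h) ≡⟨ cong ℚ.-_ (X-S (M · adj h) (nz-·ʳ {M} ne (InΓ-adj {h} e))) ⟩
      ℚ.- (ℚ.- X (M · adj h · adj Sm)) ≡⟨ solve 1 (λ y → :- (:- y) := y) refl (X (M · adj h · adj Sm)) ⟩
      X (M · adj h · adj Sm) ≡⟨ cong X (trans (·-assoc M (adj h) (adj Sm)) (trans (cong (M ·_) p) (neg-·ʳ M t))) ⟩
      X (negM (M · t)) ≡⟨ X-neg (M · t) (nz-·ʳ {M} {t} ne f) ⟩
      X (M · t) ∎

-- Powers of T and the size of the bottom row

Tⁿ : ℤ → Mat
Tⁿ n = mat (+ 1) n (+ 0) (+ 1)

unit-pair : ∀ p s → p ℤ.* s ≡ + 1 → (p ≡ + 1 × s ≡ + 1) ⊎ (p ≡ ℤ.- + 1 × s ≡ ℤ.- + 1)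
unit-pair p s e = signs p s e (ℕ.m*n≡1⇒m≡1 ℤ.∣ p ∣ ℤ.∣ s ∣ n) (ℕ.m*n≡1⇒n≡1 ℤ.∣ p ∣ ℤ.∣ s ∣ n)
  where
  n : ℤ.∣ p ∣ ℕ.* ℤ.∣ s ∣ ≡ 1
  n = trans (sym (ℤ.∣i*j∣≡∣i∣*∣j∣ p s)) (cong ℤ.∣_∣ e)
  signs : ∀ p s → p ℤ.* s ≡ + 1 → ℤ.∣ p ∣ ≡ 1 → ℤ.∣ s ∣ ≡ 1 →
    (p ≡ + 1 × s ≡ + 1) ⊎ (p ≡ ℤ.- + 1 × s ≡ ℤ.- + 1)
  signs (+ 1) (+ 1) _ refl refl = inj₁ (refl , refl)
  signs -[1+ 0 ] -[1+ 0 ] _ refl refl = inj₂ (refl , refl)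
  signs (+ 1) -[1+ 0 ] () refl refl
  signs -[1+ 0 ] (+ 1) () refl refl

Γ∞-form : ∀ γ → InΓ γ → Mat.c γ ≡ + 0 → ∃ λ n → γ ~ Tⁿ n
Γ∞-form (mat p q _ s) e refl with unit-pair p s (trans (e₁ p q s) e)
  where
  e₁ : ∀ p q s → p ℤ.* s ≡ p ℤ.* s ℤ.+ ℤ.- (q ℤ.* + 0)
  e₁ = solve-∀
... | inj₁ (refl , refl) = q , inj₁ refl
... | inj₂ (refl , refl) = ℤ.- q , inj₂ (mat-≡ refl (sym (ℤ.neg-involutive q)) refl refl)

orb-form : ∀ {M N} → O∞.Orb M N → ∃ λ n → N ~ (Tⁿ n · M)
orb-form {M} (γ , (e , z) , refl) with Γ∞-form γ e z
... | n , inj₁ refl = n , inj₁ refl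
... | n , inj₂ refl = n , inj₂ (neg-·ˡ (Tⁿ n) M)

Tⁿ-c : ∀ n M → Mat.c (Tⁿ n · M) ≡ Mat.c M
Tⁿ-c n (mat a b c d) = e₁ a c
  where
  e₁ : ∀ a c → + 0 ℤ.* a ℤ.+ + 1 ℤ.* c ≡ c
  e₁ = solve-∀

Tⁿ-d : ∀ n M → Mat.d (Tⁿ n · M) ≡ Mat.d M
Tⁿ-d n (mat a b c d) = e₁ b d
  where
  e₁ : ∀ a c → + 0 ℤ.* a ℤ.+ + 1 ℤ.* c ≡ c
  e₁ = solve-∀

-- Left multiplication by T does not touch the bottom row, so this size is constant on Γ∞-orbits.
norm : Mat → ℕ
norm M = ℤ.∣ Mat.c M ∣ ℕ.+ ℤ.∣ Mat.d M ∣

norm-orb : ∀ {M N} → O∞.Orb M N → norm N ≡ norm M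
norm-orb {M} {N} o with orb-form {M} {N} o
... | n , inj₁ refl = cong₂ (λ x y → ℤ.∣ x ∣ ℕ.+ ℤ.∣ y ∣) (Tⁿ-c n M) (Tⁿ-d n M)
... | n , inj₂ refl = trans (cong₂ ℕ._+_ (ℤ.∣-i∣≡∣i∣ (Mat.c (Tⁿ n · M))) (ℤ.∣-i∣≡∣i∣ (Mat.d (Tⁿ n · M))))
  (cong₂ (λ x y → ℤ.∣ x ∣ ℕ.+ ℤ.∣ y ∣) (Tⁿ-c n M) (Tⁿ-d n M))

-- The sum of the norms is a crude but sufficient bound for each of them: beyond it, no entry can
-- lie in the orbit of M.
bound : R → ℕ
bound [] = 0
bound ((_ , N) ∷ ξ) = norm N ℕ.+ bound ξ

pair-far : ∀ ξ M → bound ξ ℕ.< norm M → pair (χ M) ξ ≡ 0ℚ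
pair-far [] M _ = refl
pair-far ((q , N) ∷ ξ) M lt = trans (cong₂ (λ x y → q ℚ.* x ℚ.+ y) (O∞.χ-out {M} {N} ¬o) (pair-far ξ M (ℕ.≤-<-trans (ℕ.m≤n+m (bound ξ) (norm N)) lt)))
  (trans (ℚ.+-identityʳ (q ℚ.* 0ℚ)) (ℚ.*-zeroʳ q))
  where
  ¬o : ¬ O∞.Orb M N
  ¬o o = ℕ.<⇒≢ (ℕ.≤-<-trans (ℕ.m≤m+n (norm N) (bound ξ)) lt) (norm-orb {M} {N} o)

M·T : ∀ a b c d → mat a b c d · Tm ≡ mat a (a ℤ.+ b) c (c ℤ.+ d)
M·T a b c d = mat-≡ (e₁ a b) (e₂ a b) (e₁ c d) (e₂ c d)
  where
  e₁ : ∀ a b → a ℤ.* + 1 ℤ.+ b ℤ.* + 0 ≡ a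
  e₁ = solve-∀
  e₂ : ∀ a b → a ℤ.* + 1 ℤ.+ b ℤ.* + 1 ≡ a ℤ.+ b
  e₂ = solve-∀

M·T′ : ∀ a b c d → mat a b c d · T′m ≡ mat (a ℤ.+ b) b (c ℤ.+ d) d
M·T′ a b c d = mat-≡ (e₂ a b) (e₁ a b) (e₂ c d) (e₁ c d)
  where
  e₁ : ∀ a b → a ℤ.* + 0 ℤ.+ b ℤ.* + 1 ≡ b
  e₁ = solve-∀
  e₂ : ∀ a b → a ℤ.* + 1 ℤ.+ b ℤ.* + 1 ≡ a ℤ.+ b
  e₂ = solve-∀

M·adjS : ∀ a b c d → mat a b c d · adj Sm ≡ mat (ℤ.- b) a (ℤ.- d) c
M·adjS a b c d = mat-≡ (e₁ a b) (e₂ a b) (e₁ c d) (e₂ c d)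
  where
  e₁ : ∀ a b → a ℤ.* + 0 ℤ.+ b ℤ.* (ℤ.- + 1) ≡ ℤ.- b
  e₁ = solve-∀
  e₂ : ∀ a b → a ℤ.* + 1 ℤ.+ b ℤ.* + 0 ≡ a
  e₂ = solve-∀

d≢0 : ∀ {M} → det M ≢ + 0 → Mat.c M ≡ + 0 → Mat.d M ≢ + 0
d≢0 {mat a b _ _} ne refl refl = ne (e₁ a b)
  where
  e₁ : ∀ a b → a ℤ.* + 0 ℤ.+ ℤ.- (b ℤ.* + 0) ≡ + 0
  e₁ = solve-∀

a≢0 : ∀ {M} → det M ≢ + 0 → Mat.c M ≡ + 0 → Mat.a M ≢ + 0
a≢0 {mat _ b _ d} ne refl refl = ne (e₁ b d)
  where
  e₁ : ∀ b d → + 0 ℤ.* d ℤ.+ ℤ.- (b ℤ.* + 0) ≡ + 0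
  e₁ = solve-∀

-- Vanishing of X when both bottom entries are nonzero

module Vanishing (ξ : R) (IS : InI (ξ ⊗ πS)) (IU : InI (ξ ⊗ πU)) where
  open Cocycle ξ IS IU

  -- Induction on k, the number of steps that certainly carry the norm past the bound. Multiplying
  -- by T or T′ replaces (c , d) by (c , c + d) or (c + d , d), so positive rows stay positive and
  -- the norm grows by at least 1.
  X-pos : ∀ k a b m n → bound x ℕ.< k ℕ.+ (suc m ℕ.+ suc n) → det (mat a b (+ suc m) (+ suc n)) ≢ + 0 →
    X (mat a b (+ suc m) (+ suc n)) ≡ 0ℚ
  X-pos zero a b m n lt _ = pair-far x (mat a b (+ suc m) (+ suc n)) lt
  X-pos (suc k) a b m n lt ne = trans (X-three-term M ne) (cong₂ ℚ._+_
    (trans (cong X (M·T a b c d)) (X-pos k a (a ℤ.+ b) m (m ℕ.+ suc n) lt₁ (subst (λ N → det N ≢ + 0) (M·T a b c d) (nz-·ʳ {M} {Tm} ne refl))))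
    (trans (cong X (M·T′ a b c d)) (X-pos k (a ℤ.+ b) b (m ℕ.+ suc n) n lt₂ (subst (λ N → det N ≢ + 0) (M·T′ a b c d) (nz-·ʳ {M} {T′m} ne refl)))))
    where
    c = + suc m
    d = + suc n
    M = mat a b c d
    lt₁ : bound x ℕ.< k ℕ.+ (suc m ℕ.+ suc (m ℕ.+ suc n))
    lt₁ = ℕ.<-≤-trans lt (ℕ.≤-trans (ℕ.≤-reflexive (sym (ℕ.+-suc k _)))
      (ℕ.+-monoʳ-≤ k (s≤s (ℕ.m≤n+m (suc (m ℕ.+ suc n)) m))))
    lt₂ : bound x ℕ.< k ℕ.+ (suc (m ℕ.+ suc n) ℕ.+ suc n)
    lt₂ = ℕ.<-≤-trans lt (ℕ.≤-trans (ℕ.≤-reflexive (sym (ℕ.+-suc k _)))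
      (ℕ.+-monoʳ-≤ k (ℕ.≤-trans (ℕ.≤-reflexive (sym (ℕ.+-comm (suc m ℕ.+ suc n) 1))) (ℕ.+-monoʳ-≤ (suc m ℕ.+ suc n) (s≤s z≤n)))))

  X-vanish-pos : ∀ a b m n → det (mat a b (+ suc m) (+ suc n)) ≢ + 0 → X (mat a b (+ suc m) (+ suc n)) ≡ 0ℚ
  X-vanish-pos a b m n = X-pos (suc (bound x)) a b m n (ℕ.m≤m+n (suc (bound x)) _)

  X-vanish-neg : ∀ a b m n → det (mat a b -[1+ m ] -[1+ n ]) ≢ + 0 → X (mat a b -[1+ m ] -[1+ n ]) ≡ 0ℚ
  X-vanish-neg a b m n ne = trans (sym (X-neg M ne)) (X-vanish-pos (ℤ.- a) (ℤ.- b) m n (ne ∘ trans (sym (det-neg M))))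
    where M = mat a b -[1+ m ] -[1+ n ]

  -- Multiplication by S⁻¹ turns the bottom row (c , d) into (-d , c), so entries of opposite sign
  -- become entries of equal sign.
  X-rotate : ∀ a b c d → det (mat a b c d) ≢ + 0 → (det (mat (ℤ.- b) a (ℤ.- d) c) ≢ + 0 → X (mat (ℤ.- b) a (ℤ.- d) c) ≡ 0ℚ) →
    X (mat a b c d) ≡ 0ℚ
  X-rotate a b c d ne h = trans (X-S (mat a b c d) ne)
    (cong ℚ.-_ (trans (cong X (M·adjS a b c d)) (h (subst (λ N → det N ≢ + 0) (M·adjS a b c d) (nz-·ʳ {mat a b c d} {adj Sm} ne refl)))))

  X-vanish : ∀ M → det M ≢ + 0 → Mat.c M ≢ + 0 → Mat.d M ≢ + 0 → X M ≡ 0ℚ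
  X-vanish (mat a b (+ 0) d) _ c≢0 _ = ⊥-elim (c≢0 refl)
  X-vanish (mat a b c (+ 0)) _ _ d≢0 = ⊥-elim (d≢0 refl)
  X-vanish (mat a b (+ suc m) (+ suc n)) ne _ _ = X-vanish-pos a b m n ne
  X-vanish (mat a b -[1+ m ] -[1+ n ]) ne _ _ = X-vanish-neg a b m n ne
  X-vanish (mat a b (+ suc m) -[1+ n ]) ne _ _ = X-rotate a b (+ suc m) -[1+ n ] ne (X-vanish-pos (ℤ.- b) a n m)
  X-vanish (mat a b -[1+ m ] (+ suc n)) ne _ _ = X-rotate a b -[1+ m ] (+ suc n) ne (X-vanish-neg (ℤ.- b) a n m)

  -- When c = 0, the bottom row of MT′ is (d , d) with d ≠ 0, so the last term of the three-term
  -- relation vanishes.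
  X-T : ∀ M → det M ≢ + 0 → Mat.c M ≡ + 0 → X (M · Tm) ≡ X M
  X-T M@(mat a b _ d) ne refl = sym (trans (X-three-term M ne) (trans (cong (X (M · Tm) ℚ.+_)
    (trans (cong X e) (X-vanish (mat (a ℤ.+ b) b d d) (subst (λ N → det N ≢ + 0) e (nz-·ʳ {M} {T′m} ne refl)) d≢ d≢))) (ℚ.+-identityʳ _)))
    where
    d≢ = d≢0 {M} ne refl
    e : M · T′m ≡ mat (a ℤ.+ b) b d d
    e = trans (M·T′ a b (+ 0) d) (mat-≡ refl refl (ℤ.+-identityˡ d) refl)

-- The lower-left entry of γM is ra with a ≠ 0. Hence matrices of Δ fixing ∞ that are equivalent
-- under Γ are already equivalent under Γ∞.
Γ⇒Γ∞ : ∀ γ M → det M ≢ + 0 → Mat.c M ≡ + 0 → Mat.c (γ · M) ≡ + 0 → Mat.c γ ≡ + 0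
Γ⇒Γ∞ (mat p q r s) M@(mat a b _ d) ne refl e with ℤ.i*j≡0⇒i≡0∨j≡0 r (trans (e₁ r s a) e)
  where
  e₁ : ∀ r s a → r ℤ.* a ≡ r ℤ.* a ℤ.+ s ℤ.* + 0
  e₁ = solve-∀
... | inj₁ z = z
... | inj₂ z = ⊥-elim (a≢0 {M} ne refl z)

-- Generation of Γ by S and T

Tⁿ-· : ∀ m n → Tⁿ m · Tⁿ n ≡ Tⁿ (m ℤ.+ n)
Tⁿ-· m n = mat-≡ (e₁ m) (e₂ m n) refl (e₃ n)
  where
  e₁ : ∀ m → + 1 ℤ.* + 1 ℤ.+ m ℤ.* + 0 ≡ + 1
  e₁ = solve-∀
  e₂ : ∀ m n → + 1 ℤ.* n ℤ.+ m ℤ.* + 1 ≡ m ℤ.+ n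
  e₂ = solve-∀
  e₃ : ∀ n → + 0 ℤ.* n ℤ.+ + 1 ℤ.* + 1 ≡ + 1
  e₃ = solve-∀

det-Tⁿ : ∀ n → InΓ (Tⁿ n)
det-Tⁿ n = e₁ n
  where
  e₁ : ∀ n → + 1 ℤ.* + 1 ℤ.+ ℤ.- (n ℤ.* + 0) ≡ + 1
  e₁ = solve-∀

-- Euclid's algorithm on the bottom row.
Γ-generated : (P : Mat → Set) → (∀ {g h} → P g → P h → P (g · h)) → P Sm → P Tm → P (adj Tm) → ∀ g → InΓ g → P g
Γ-generated P P-· PS PT PT⁻¹ g e = go (suc ℤ.∣ Mat.c g ∣) g e ℕ.≤-refl
  where
  P-I : P I₂
  -- As matrices S² = -1, so the identity is S⁴.
  P-I = P-· (P-· PS PS) (P-· PS PS)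
  P-neg : ∀ {g} → P g → P (negM g)
  P-neg {g} p = subst P (trans (neg-·ˡ I₂ g) (cong negM (·-identityˡ g))) (P-· (P-· PS PS) p)
  PTⁿ : ∀ n → P (Tⁿ n)
  PTⁿ (+ zero) = P-I
  PTⁿ (+ suc n) = subst P (Tⁿ-· (+ 1) (+ n)) (P-· PT (PTⁿ (+ n)))
  PTⁿ -[1+ zero ] = PT⁻¹
  PTⁿ -[1+ suc n ] = subst P (Tⁿ-· -[1+ 0 ] -[1+ n ]) (P-· PT⁻¹ (PTⁿ -[1+ n ]))
  go : ∀ k g → InΓ g → ℤ.∣ Mat.c g ∣ ℕ.< k → P g
  go (suc k) g e lt with Mat.c g ℤ.≟ + 0
  ... | yes z with Γ∞-form g e z
  ...   | n , inj₁ refl = PTⁿ n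
  ...   | n , inj₂ refl = P-neg (PTⁿ n)
  go (suc k) g@(mat a b c d) e (s≤s lt) | no c≢0 =
    -- -S is the inverse of S, and `ℤ.- (ℤ.- q)` is the entry that `adj` produces when inverting
    -- T^(-q).
    subst P back (P-· (P-· (go k g′ e′ lt′) (P-neg PS)) (PTⁿ (ℤ.- (ℤ.- q))))
    where
    instance
      nz : ℤ.NonZero c
      nz = ℤ.≢-nonZero c≢0
    -- The lower-left entry of g T^(-q) S is d - qc, the remainder of d by c, which is smaller than
    -- the absolute value of c.
    q = d /ᶻ c
    g₁ = g · Tⁿ (ℤ.- q)
    g′ = g₁ · Sm
    e₁ : InΓ g₁
    e₁ = InΓ-· {g} {Tⁿ (ℤ.- q)} e (det-Tⁿ (ℤ.- q))
    e′ : InΓ g′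
    e′ = InΓ-· {g₁} {Sm} e₁ refl
    ring : ∀ c q r → (c ℤ.* + 1 ℤ.+ (r ℤ.+ q ℤ.* c) ℤ.* + 0) ℤ.* + 0 ℤ.+ (c ℤ.* (ℤ.- q) ℤ.+ (r ℤ.+ q ℤ.* c) ℤ.* + 1) ℤ.* + 1 ≡ r
    ring = solve-∀
    c′ : Mat.c g′ ≡ + (d %ᶻ c)
    c′ = trans (cong (λ y → (c ℤ.* + 1 ℤ.+ y ℤ.* + 0) ℤ.* + 0 ℤ.+ (c ℤ.* (ℤ.- q) ℤ.+ y ℤ.* + 1) ℤ.* + 1) (div-eq d c)) (ring c q (+ (d %ᶻ c)))
    lt′ : ℤ.∣ Mat.c g′ ∣ ℕ.< k
    lt′ = ℕ.≤-trans (subst (λ z → ℤ.∣ z ∣ ℕ.< ℤ.∣ c ∣) (sym c′) (mod-< d c)) lt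
    back : g′ · adj Sm · Tⁿ (ℤ.- (ℤ.- q)) ≡ g
    back = trans (cong (_· Tⁿ (ℤ.- (ℤ.- q))) (·-cancelʳ g₁ {Sm} refl)) (·-cancelʳ g {Tⁿ (ℤ.- q)} (det-Tⁿ (ℤ.- q)))

-- Congruences modulo (1 − T)ℚ[Δ]

module OΓ = Orbits Γ

module Coset (δ : Mat) where

  Δ-intro : ∀ {g h M} → InΓ g → InΓ h → M ≡ g · δ · h → InΔ δ M
  Δ-intro {g} {h} e f p = g , h , e , f , inj₁ p

  Δ-elim : ∀ {M} → InΔ δ M → ∃ λ g → ∃ λ h → InΓ g × InΓ h × M ≡ g · δ · h
  Δ-elim (g , h , e , f , inj₁ p) = g , h , e , f , p
  Δ-elim (g , h , e , f , inj₂ p) = negM g , h , InΓ-neg {g} e , f ,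
    trans p (trans (sym (neg-·ˡ (g · δ) h)) (cong (_· h) (sym (neg-·ˡ g δ))))

  Δ-self : InΔ δ δ
  Δ-self = Δ-intro {I₂} {I₂} refl refl (sym (trans (·-identityʳ (I₂ · δ)) (·-identityˡ δ)))

  Δ-·ˡ : ∀ {g M} → InΓ g → InΔ δ M → InΔ δ (g · M)
  Δ-·ˡ {k} {M} u m with Δ-elim {M} m
  ... | g , h , e , f , p = Δ-intro {k · g} {h} (InΓ-· {k} {g} u e) f
    (trans (cong (k ·_) p) (trans (sym (·-assoc k (g · δ) h)) (cong (_· h) (sym (·-assoc k g δ)))))

  Δ-·ʳ : ∀ {g M} → InΓ g → InΔ δ M → InΔ δ (M · g)
  Δ-·ʳ {k} {M} u m with Δ-elim {M} m
  ... | g , h , e , f , p = Δ-intro {g} {h · k} e (InΓ-· {h} {k} f u)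
    (trans (cong (_· k) p) (·-assoc (g · δ) h k))

  Δ-~ : ∀ {M N} → M ~ N → InΔ δ M → InΔ δ N
  Δ-~ p (g , h , e , f , q) = g , h , e , f , ~-trans (~-sym p) q

  Δ-det : ∀ {M} → InΔ δ M → det M ≡ det δ
  Δ-det {M} m with Δ-elim {M} m
  ... | g , h , e , f , p = trans (cong det p) (trans (det-I·ʳ {h} (g · δ) f) (det-I·ˡ {g} δ e))

  -- Stronger than `InRΔ`, since cancelling entries are constrained too; in this form it passes
  -- through list operations entry by entry.
  AllΔ : R → Set
  AllΔ = All (λ e → InΔ δ (proj₂ e))

  AllΔ⇒InRΔ : ∀ ξ → AllΔ ξ → InRΔ δ ξ
  AllΔ⇒InRΔ [] [] M nz = ⊥-elim (nz refl)
  AllΔ⇒InRΔ ((q , N) ∷ ξ) (n ∷ ns) M nz = by-cases (N ~? M)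
    where
    by-cases : Dec (N ~ M) → InΔ δ M
    by-cases (yes p) = Δ-~ {N} {M} p n
    by-cases (no ¬p) = AllΔ⇒InRΔ ξ ns M λ z →
      nz (trans (cong (λ b → if b then q ℚ.+ coeff ξ M else coeff ξ M) (dec-false (N ~? M) ¬p)) z)

  AllΔ-⊙ : ∀ q {ξ} → AllΔ ξ → AllΔ (q ⊙ ξ)
  AllΔ-⊙ q [] = []
  AllΔ-⊙ q (m ∷ ms) = m ∷ AllΔ-⊙ q ms

  AllΔ-⊖ : ∀ {ξ η} → AllΔ ξ → AllΔ η → AllΔ (ξ ⊖ η)
  AllΔ-⊖ ms ns = ++⁺ ms (AllΔ-⊙ (ℚ.- 1ℚ) ns)

  AllΔ-⊗ : ∀ ξ η → All (λ e → All (λ f → InΔ δ (proj₂ e · proj₂ f)) η) ξ → AllΔ (ξ ⊗ η)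
  AllΔ-⊗ [] η [] = []
  AllΔ-⊗ (e ∷ ξ) η (a ∷ as) = ++⁺ (map⁺ a) (AllΔ-⊗ ξ η as)

  AllΔ-1- : ∀ {g} → InΓ g → ∀ {ξ} → AllΔ ξ → AllΔ ((one ⊖ [ g ]) ⊗ ξ)
  AllΔ-1- {g} u {ξ} ms = AllΔ-⊗ (one ⊖ [ g ]) ξ
    (All.map (λ {e} → Δ-·ˡ {I₂} {proj₂ e} refl) ms ∷ All.map (λ {e} → Δ-·ˡ {g} {proj₂ e} u) ms ∷ [])

  AllΔ--1 : ∀ {g} → InΓ g → ∀ {ξ} → AllΔ ξ → AllΔ (ξ ⊗ (one ⊖ [ g ]))
  AllΔ--1 {g} u {ξ} ms = AllΔ-⊗ ξ (one ⊖ [ g ])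
    (All.map (λ {e} m → Δ-·ʳ {I₂} {proj₂ e} refl m ∷ Δ-·ʳ {g} {proj₂ e} u m ∷ []) ms)

  -- The transpose of left multiplication by 1 - T: by `pair-1-`, pairing `∂ φ` with η is pairing φ
  -- with (1 - T)η.
  ∂ : (Mat → ℚ) → Mat → ℚ
  ∂ φ N = φ N ℚ.- φ (Tm · N)

  -- A witness that N - M lies in (1 - T)ℚ[Δ], phrased through functionals.
  Move : Mat → Mat → Set
  Move M N = ∃ λ η → AllΔ η × (∀ φ → φ N ≡ φ M ℚ.+ pair (∂ φ) η)

  -- Telescoping: each step adds T(TⁿM) - TⁿM = -(1 - T)TⁿM, which explains the coefficient -1.
  T-orbit-move : ∀ n M → InΔ δ M → Move M (Tⁿ (+ n) · M)
  T-orbit-move zero M m = [] , [] , λ φ → trans (cong φ (·-identityˡ M)) (sym (ℚ.+-identityʳ (φ M)))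
  T-orbit-move (suc n) M m with T-orbit-move n M m
  ... | η , a , h = (ℚ.- 1ℚ , N) ∷ η , Δ-·ˡ {Tⁿ (+ n)} {M} (det-Tⁿ (+ n)) m ∷ a , step
    where
    N = Tⁿ (+ n) · M
    T·N : Tm · N ≡ Tⁿ (+ suc n) · M
    T·N = trans (sym (·-assoc Tm (Tⁿ (+ n)) M)) (cong (_· M) (Tⁿ-· (+ 1) (+ n)))
    step : ∀ φ → φ (Tⁿ (+ suc n) · M) ≡ φ M ℚ.+ pair (∂ φ) ((ℚ.- 1ℚ , N) ∷ η)
    step φ = begin
      φ (Tⁿ (+ suc n) · M) ≡⟨ cong φ T·N ⟨
      φ (Tm · N) ≡⟨ solve 2 (λ s t → t := s :+ :- con 1ℚ :* (s :- t)) refl (φ N) (φ (Tm · N)) ⟩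
      φ N ℚ.+ ℚ.- 1ℚ ℚ.* ∂ φ N ≡⟨ cong (ℚ._+ ℚ.- 1ℚ ℚ.* ∂ φ N) (h φ) ⟩
      φ M ℚ.+ pair (∂ φ) η ℚ.+ ℚ.- 1ℚ ℚ.* ∂ φ N
        ≡⟨ solve 3 (λ a b c → a :+ b :+ c := a :+ (c :+ b)) refl (φ M) (pair (∂ φ) η) (ℚ.- 1ℚ ℚ.* ∂ φ N) ⟩
      φ M ℚ.+ pair (∂ φ) ((ℚ.- 1ℚ , N) ∷ η) ∎
      where open ≡-Reasoning

  move-sym : ∀ {M N} → Move M N → Move N M
  move-sym {M} {N} (η , a , h) = (ℚ.- 1ℚ) ⊙ η , AllΔ-⊙ (ℚ.- 1ℚ) a , back
    where
    back : ∀ φ → φ M ≡ φ N ℚ.+ pair (∂ φ) ((ℚ.- 1ℚ) ⊙ η)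
    back φ = begin
      φ M ≡⟨ solve 2 (λ s t → s := (s :+ t) :+ :- con 1ℚ :* t) refl (φ M) (pair (∂ φ) η) ⟩
      (φ M ℚ.+ pair (∂ φ) η) ℚ.+ ℚ.- 1ℚ ℚ.* pair (∂ φ) η
        ≡⟨ cong₂ ℚ._+_ (sym (h φ)) (sym (pair-⊙ (∂ φ) (ℚ.- 1ℚ) η)) ⟩
      φ N ℚ.+ pair (∂ φ) ((ℚ.- 1ℚ) ⊙ η) ∎
      where open ≡-Reasoning

  Tⁿ-move : ∀ n M → InΔ δ M → Move M (Tⁿ n · M)
  Tⁿ-move (+ n) M m = T-orbit-move n M m
  -- M is reached from T^(-k-1)M by k + 1 forward steps; that move is reversed.
  Tⁿ-move -[1+ k ] M m = move-sym {Tⁿ -[1+ k ] · M} {M}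
    (subst (Move (Tⁿ -[1+ k ] · M)) (·-cancelˡ {Tⁿ -[1+ k ]} M (det-Tⁿ -[1+ k ]))
      (T-orbit-move (suc k) (Tⁿ -[1+ k ] · M) (Δ-·ˡ {Tⁿ -[1+ k ]} {M} (det-Tⁿ -[1+ k ]) m)))

  orb-move : ∀ {M N} → InΔ δ M → O∞.Orb M N → ∃ λ η → AllΔ η × (∀ φ → Even φ → φ N ≡ φ M ℚ.+ pair (∂ φ) η)
  orb-move {M} {N} m o with orb-form {M} {N} o
  ... | n , r with Tⁿ-move n M m
  ...   | η , a , h = η , a , λ φ ev → trans (even-~ {φ} ev r) (h φ)

  -- Each entry is moved to M separately, after which only the total of the coefficients is left at
  -- M.
  orbit-sum-move : ∀ {M} → InΔ δ M → ∀ ζ → All (λ e → O∞.Orb M (proj₂ e)) ζ →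
    ∃ λ η → AllΔ η × (∀ φ → Even φ → pair φ ζ ≡ pair (λ _ → 1ℚ) ζ ℚ.* φ M ℚ.+ pair (∂ φ) η)
  orbit-sum-move {M} m [] [] = [] , [] , λ φ _ → sym (trans (ℚ.+-identityʳ (0ℚ ℚ.* φ M)) (ℚ.*-zeroˡ (φ M)))
  orbit-sum-move {M} m ((q , N) ∷ ζ) (o ∷ os) with orb-move {M} {N} m o | orbit-sum-move {M} m ζ os
  ... | η₁ , a₁ , h₁ | η₂ , a₂ , h₂ = q ⊙ η₁ ++ η₂ , ++⁺ (AllΔ-⊙ q a₁) a₂ , step
    where
    step : ∀ φ → Even φ → q ℚ.* φ N ℚ.+ pair φ ζ ≡
      (q ℚ.* 1ℚ ℚ.+ pair (λ _ → 1ℚ) ζ) ℚ.* φ M ℚ.+ pair (∂ φ) (q ⊙ η₁ ++ η₂)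
    step φ ev = trans (cong₂ (λ x y → q ℚ.* x ℚ.+ y) (h₁ φ ev) (h₂ φ ev)) (trans
      (solve 5 (λ q f a s b → q :* (f :+ a) :+ (s :* f :+ b) := (q :* con 1ℚ :+ s) :* f :+ (q :* a :+ b)) refl
        q (φ M) (pair (∂ φ) η₁) (pair (λ _ → 1ℚ) ζ) (pair (∂ φ) η₂))
      (cong ((q ℚ.* 1ℚ ℚ.+ pair (λ _ → 1ℚ) ζ) ℚ.* φ M ℚ.+_)
        (sym (trans (pair-++ (∂ φ) (q ⊙ η₁) η₂) (cong (ℚ._+ pair (∂ φ) η₂) (pair-⊙ (∂ φ) q η₁))))))

  -- The kernel of ℚ[Δ] → ℚ[Γ∞∖Δ] is (1 - T)ℚ[Δ]. The orbit of the first entry has total coefficient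
  -- 0, so `orbit-sum-move` puts its part into (1 - T)ℚ[Δ]; the remaining shorter list has the same
  -- vanishing orbit sums.
  orbit-sums-vanish⇒∂ : det δ ≢ + 0 → ∀ ζ → AllΔ ζ → (∀ M → InΔ δ M → pair (χ M) ζ ≡ 0ℚ) →
    ∃ λ η → AllΔ η × (∀ φ → Even φ → pair φ ζ ≡ pair (∂ φ) η)
  orbit-sums-vanish⇒∂ ne ζ = go (length ζ) ζ ℕ.≤-refl
    where
    go : ∀ n ζ → length ζ ℕ.≤ n → AllΔ ζ → (∀ M → InΔ δ M → pair (χ M) ζ ≡ 0ℚ) →
      ∃ λ η → AllΔ η × (∀ φ → Even φ → pair φ ζ ≡ pair (∂ φ) η)
    go _ [] _ _ _ = [] , [] , λ _ _ → refl
    go (suc n) ζ@((q , M) ∷ ξ) (s≤s le) (m ∷ ms) z = η₁ ++ η₂ , ++⁺ a₁ a₂ , step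
      where
      neM : det M ≢ + 0
      neM = ne ∘ trans (sym (Δ-det {M} m))
      t = O∞.test M
      ζ₁ = restrict t ζ
      ζ₂ = restrict (not ∘ t) ζ
      IH₁ = orbit-sum-move {M} m ζ₁ (All.map (λ {e} → O∞.test-sound M (proj₂ e)) (restrict-holds t ζ))
      η₁ = proj₁ IH₁
      a₁ = proj₁ (proj₂ IH₁)
      -- Adding up the coefficients over the orbit of M is pairing ζ with `χ M`.
      mass : pair (λ _ → 1ℚ) ζ₁ ≡ 0ℚ
      mass = trans (pair-restrict (λ _ → 1ℚ) t ζ) (z M m)
      z₂ : ∀ N → InΔ δ N → pair (χ N) ζ₂ ≡ 0ℚ
      z₂ N n = trans (sym (pair-remove (χ N) t M
          (λ K e → sym (O∞.χ-congʳ {N} {M} {K} (ne ∘ trans (sym (Δ-det {N} n))) (O∞.test-sound M K e))) ζ (z M m)))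
        (z N n)
      IH₂ = go n ζ₂ (ℕ.≤-trans (length-remove t q M ξ (O∞.test-in {M} {M} neM (O∞.orb-refl M))) le)
        (restrict-All (not ∘ t) ζ (m ∷ ms)) z₂
      η₂ = proj₁ IH₂
      a₂ = proj₁ (proj₂ IH₂)
      step : ∀ φ → Even φ → pair φ ζ ≡ pair (∂ φ) (η₁ ++ η₂)
      step φ ev = begin
        pair φ ζ ≡⟨ pair-split φ t ζ ⟩
        pair φ ζ₁ ℚ.+ pair φ ζ₂ ≡⟨ cong₂ ℚ._+_ (proj₂ (proj₂ IH₁) φ ev) (proj₂ (proj₂ IH₂) φ ev) ⟩
        pair (λ _ → 1ℚ) ζ₁ ℚ.* φ M ℚ.+ pair (∂ φ) η₁ ℚ.+ pair (∂ φ) η₂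
          ≡⟨ cong (λ s → s ℚ.* φ M ℚ.+ pair (∂ φ) η₁ ℚ.+ pair (∂ φ) η₂) mass ⟩
        0ℚ ℚ.* φ M ℚ.+ pair (∂ φ) η₁ ℚ.+ pair (∂ φ) η₂
          ≡⟨ solve 3 (λ f a b → con 0ℚ :* f :+ a :+ b := a :+ b) refl (φ M) (pair (∂ φ) η₁) (pair (∂ φ) η₂) ⟩
        pair (∂ φ) η₁ ℚ.+ pair (∂ φ) η₂ ≡⟨ pair-++ (∂ φ) η₁ η₂ ⟨
        pair (∂ φ) (η₁ ++ η₂) ∎
        where open ≡-Reasoning

-- Combinations of the representatives

weighted : (Mat → ℚ) → List Mat → R
weighted w = map (λ M → (w M , M))

pair-weighted-zero : ∀ {φ} w L → (∀ i → φ (lookup L i) ≡ 0ℚ) → pair φ (weighted w L) ≡ 0ℚ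
pair-weighted-zero w [] h = refl
pair-weighted-zero w (M ∷ L) h = trans (cong₂ (λ x y → w M ℚ.* x ℚ.+ y) (h zero) (pair-weighted-zero w L (h ∘ suc)))
  (trans (ℚ.+-identityʳ (w M ℚ.* 0ℚ)) (ℚ.*-zeroʳ (w M)))

pair-weighted-single : ∀ {φ} w L i → φ (lookup L i) ≡ 1ℚ → (∀ j → j ≢ i → φ (lookup L j) ≡ 0ℚ) →
  pair φ (weighted w L) ≡ w (lookup L i)
pair-weighted-single w (M ∷ L) zero one zer = trans (cong₂ (λ x y → w M ℚ.* x ℚ.+ y) one
    (pair-weighted-zero w L (λ j → zer (suc j) λ ())))
  (trans (ℚ.+-identityʳ (w M ℚ.* 1ℚ)) (ℚ.*-identityʳ (w M)))
pair-weighted-single w (M ∷ L) (suc i) one zer = trans (cong₂ (λ x y → w M ℚ.* x ℚ.+ y) (zer zero λ ())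
    (pair-weighted-single w L i one (λ j ne → zer (suc j) (ne ∘ Fin.suc-injective))))
  (trans (cong (ℚ._+ w (lookup L i)) (ℚ.*-zeroʳ (w M))) (ℚ.+-identityˡ (w (lookup L i))))

-- Subgroups between Γ∞ and Γ. The representatives are pairwise inequivalent under each of them, so
-- coefficients in ℚ[Γ∞∖Δ] and in ℚ[Γ∖Δ] are computed by one lemma.
record Between (G : Subgroup) : Set where
  field
    ∞⊆ : ∀ {g} → InΓ g → Mat.c g ≡ + 0 → Subgroup.K G g

Between-Γ∞ : Between Γ∞
Between-Γ∞ = record { ∞⊆ = λ e z → e , z }

Between-Γ : Between Γ
Between-Γ = record { ∞⊆ = λ e _ → e }

orb-c : ∀ {M N} → O∞.Orb M N → Mat.c M ≡ + 0 → Mat.c N ≡ + 0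
orb-c {M} (γ , (_ , z) , refl) e = c-· {γ} {M} z e

pair-invariant : ∀ {φ : Mat → ℚ} {g : Mat} ζ → (∀ N → φ (g · N) ≡ φ N) → pair (λ N → φ N ℚ.- φ (g · N)) ζ ≡ 0ℚ
pair-invariant {φ} {g} ζ inv = trans
  (pair-cong {λ N → φ N ℚ.- φ (g · N)} {λ _ → 0ℚ} (λ N → trans (cong (λ s → φ N ℚ.- s) (inv N)) (ℚ.+-inverseʳ (φ N))) ζ)
  (pair-zero ζ)

-- The number α for a fixed ξ

module Proof (δ : Mat) (detδ>0 : + 0 ℤ.< det δ) (L : List Mat) (reps : IsInftyReps δ L)
             (ξ : R) (ξ∈AΔ : InAΔ δ ξ) where

  open Coset δ

  IS : InI (ξ ⊗ πS)
  IS = proj₁ (proj₂ (proj₁ ξ∈AΔ))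

  IU : InI (ξ ⊗ πU)
  IU = proj₂ (proj₂ (proj₁ ξ∈AΔ))

  open Cocycle ξ IS IU
  open Vanishing ξ IS IU

  δ≢0 : det δ ≢ + 0
  δ≢0 = ℤ.<⇒≢ detδ>0 ∘ sym

  Δ-nz : ∀ {M} → InΔ δ M → det M ≢ + 0
  Δ-nz {M} m = δ≢0 ∘ trans (sym (Δ-det {M} m))

  rep∈Δ : ∀ i → InΔ δ (lookup L i)
  rep∈Δ i = proj₁ (All.lookup (proj₁ reps) (∈-lookup i))

  rep-c : ∀ i → Mat.c (lookup L i) ≡ + 0
  rep-c i = proj₂ (All.lookup (proj₁ reps) (∈-lookup i))

  rep-unique : ∀ i j → OΓ.Orb (lookup L j) (lookup L i) → i ≡ j
  rep-unique i j (γ , e , p) = proj₁ (proj₂ reps) i j (γ , e , inj₁ p)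

  rep-of : ∀ M → InΔ δ M → ∃ λ i → OΓ.Orb (lookup L i) M
  rep-of M m with proj₂ (proj₂ reps) M m
  ... | i , γ , e , inj₁ p = i , γ , e , p
  ... | i , γ , e , inj₂ p = i , negM γ , InΓ-neg {γ} e , trans p (sym (neg-·ˡ γ (lookup L i)))

  Γ∞-orb : ∀ {M N} → det M ≢ + 0 → Mat.c M ≡ + 0 → Mat.c N ≡ + 0 → OΓ.Orb M N → O∞.Orb M N
  Γ∞-orb {M} ne z z′ (γ , e , refl) = γ , (e , Γ⇒Γ∞ γ M ne z z′) , refl

  module _ {G : Subgroup} (bt : Between G) where
    open Orbits G using () renaming (χ to χG; Orb to OrbG)
    private module OG = Orbits G

    -- M lies in the orbit of the i-th representative because the subgroup contains Γ∞, and of no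
    -- other because equivalence under the subgroup implies equivalence under Γ.
    pair-rep : ∀ w i M → O∞.Orb (lookup L i) M → pair (χG M) (weighted w L) ≡ w (lookup L i)
    pair-rep w i M o@(γ , (e , z) , p) = pair-weighted-single {χG M} w L i
      (OG.χ-in {M} {lookup L i} neM (OG.orb-sym {lookup L i} {M} oG))
      λ j j≢i → OG.χ-out {M} {lookup L j} λ o′ → j≢i (rep-unique j i (widen (OG.orb-trans {lookup L i} {M} {lookup L j} oG o′)))
      where
      neM : det M ≢ + 0
      neM = Δ-nz (rep∈Δ i) ∘ trans (sym (O∞.orb-det {lookup L i} {M} o))
      oG : OrbG (lookup L i) M
      oG = γ , Between.∞⊆ bt {γ} e z , p
      widen : ∀ {M N} → OrbG M N → OΓ.Orb M N
      widen (γ , k , p) = γ , Subgroup.K⊆Γ G k , p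

  pair-off-∞ : ∀ w M → Mat.c M ≢ + 0 → pair (χ M) (weighted w L) ≡ 0ℚ
  pair-off-∞ w M c≢0 = pair-weighted-zero {χ M} w L λ i → O∞.χ-out {M} {lookup L i} λ o →
    c≢0 (orb-c {lookup L i} {M} (O∞.orb-sym {M} {lookup L i} o) (rep-c i))

  -- M and its representative both fix ∞, so they share a Γ∞-orbit and hence a value of X. Taken
  -- with Γ∞ this compares x with V(1 - S); taken with Γ it evaluates the image of V in ℚ[Γ∖Δ].
  pair-∞ : ∀ {G} → Between G → ∀ M → InΔ δ M → Mat.c M ≡ + 0 → pair (Orbits.χ G M) (weighted X L) ≡ X M
  pair-∞ bt M m z with rep-of M m
  ... | i , o = trans (pair-rep bt X i M o∞) (X-orb {lookup L i} {M} (Δ-nz (rep∈Δ i)) o∞)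
    where
    o∞ : O∞.Orb (lookup L i) M
    o∞ = Γ∞-orb {lookup L i} {M} (Δ-nz (rep∈Δ i)) (rep-c i) z o

  V : R
  V = weighted X L

  Q : Mat → ℚ
  Q M = pair (χ M) V

  c-adjS : ∀ M → Mat.c (M · adj Sm) ≡ ℤ.- Mat.d M
  c-adjS (mat a b c d) = cong Mat.c (M·adjS a b c d)

  -≢0 : ∀ {z} → z ≢ + 0 → ℤ.- z ≢ + 0
  -≢0 ne e = ne (ℤ.neg-injective e)

  -- Q(M) vanishes unless c = 0, and Q(MS⁻¹) unless d = 0; both cannot occur as det M ≠ 0. In these
  -- two cases the surviving term is X(M), the second time by `X-S`; otherwise X(M) = 0.
  X-from-V : ∀ M → InΔ δ M → X M ≡ Q M ℚ.- Q (M · adj Sm)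
  X-from-V M m with Mat.c M ℤ.≟ + 0 | Mat.d M ℤ.≟ + 0
  ... | yes z | _ = sym (trans (cong₂ ℚ._-_ (pair-∞ Between-Γ∞ M m z)
      (pair-off-∞ X (M · adj Sm) (-≢0 (d≢0 {M} (Δ-nz m) z) ∘ trans (sym (c-adjS M)))))
    (ℚ.+-identityʳ (X M)))
  ... | no c≢0 | yes z = trans (X-S M (Δ-nz m)) (sym (trans (cong₂ ℚ._-_ (pair-off-∞ X M c≢0)
      (pair-∞ Between-Γ∞ (M · adj Sm) (Δ-·ʳ {adj Sm} {M} refl m) (trans (c-adjS M) (cong ℤ.-_ z))))
    (ℚ.+-identityˡ (ℚ.- X (M · adj Sm)))))
  ... | no c≢0 | no d≢ = trans (X-vanish M (Δ-nz m) c≢0 d≢) (sym (cong₂ ℚ._-_ (pair-off-∞ X M c≢0)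
      (pair-off-∞ X (M · adj Sm) (-≢0 d≢ ∘ trans (sym (c-adjS M))))))

  pair-χ-⊗1-S : ∀ {G} M → det M ≢ + 0 → ∀ v → pair (Orbits.χ G M) (v ⊗ (one ⊖ [ Sm ])) ≡
    pair (Orbits.χ G M) v ℚ.- pair (Orbits.χ G (M · adj Sm)) v
  pair-χ-⊗1-S {G} M ne v = trans (pair--1 (Orbits.χ G M) v Sm)
    (cong (λ s → pair (Orbits.χ G M) v ℚ.- s) (pair-cong (λ N → Orbits.χ-·ʳ G {M} {Sm} N ne refl) v))

  ξ′ : R
  ξ′ = support ξ

  ξ′∈Δ : AllΔ ξ′
  ξ′∈Δ = All.map (λ {e} → proj₂ ξ∈AΔ (proj₂ e)) (support-All ξ)

  V∈Δ : ∀ {w} → AllΔ (weighted w L)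
  V∈Δ {w} = map⁺ (All.map proj₁ (proj₁ reps))

  x′ : R
  x′ = (one ⊖ [ Sm ]) ⊗ ξ′

  pair-x′ : ∀ {φ} → Even φ → pair φ x′ ≡ pair φ x
  pair-x′ {φ} ev = trans (pair-1- φ Sm ξ′) (trans
    (pair-support {λ N → φ N ℚ.- φ (Sm · N)} (λ N → cong₂ ℚ._-_ (ev N) (even-·ˡ {φ} ev Sm N)) ξ)
    (sym (pair-1- φ Sm ξ)))

  y : R
  y = V ⊗ (one ⊖ [ Sm ])

  -- This is x ≡ V(1 - S): by `X-from-V` both have the same coefficients on Γ∞-orbits, so their
  -- difference is in (1 - T)ℚ[Δ].
  decomposition : ∃ λ η → AllΔ η × (∀ φ → Even φ → pair φ x ≡ pair φ y ℚ.+ pair (∂ φ) η)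
  decomposition = proj₁ E , proj₁ (proj₂ E) , λ φ ev → trans
    (solve 2 (λ p q → p := q :+ (p :- q)) refl (pair φ x) (pair φ y))
    (cong (pair φ y ℚ.+_) (trans (cong (λ s → s ℚ.- pair φ y) (sym (pair-x′ {φ} ev)))
      (trans (sym (pair-⊖ φ x′ y)) (proj₂ (proj₂ E) φ ev))))
    where
    sums : ∀ M → InΔ δ M → pair (χ M) (x′ ⊖ y) ≡ 0ℚ
    sums M m = trans (pair-⊖ (χ M) x′ y) (trans (cong₂ ℚ._-_
      (trans (pair-x′ {χ M} (O∞.χ-even {M} (Δ-nz m))) (X-from-V M m)) (pair-χ-⊗1-S {Γ∞} M (Δ-nz m) V))
      (ℚ.+-inverseʳ (Q M ℚ.- Q (M · adj Sm))))
    E : ∃ λ η → AllΔ η × (∀ φ → Even φ → pair φ (x′ ⊖ y) ≡ pair (∂ φ) η)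
    E = orbit-sums-vanish⇒∂ δ≢0 (x′ ⊖ y) (AllΔ-⊖ {x′} {y} (AllΔ-1- {Sm} refl {ξ′} ξ′∈Δ) (AllΔ--1 {Sm} refl {V} (V∈Δ {X}))) sums

  -- The image of V in ℚ[Γ\Δ]: it is invariant under S and T, hence constant.
  f : Mat → ℚ
  f M = pair (OΓ.χ M) V

  f-orb : ∀ {M N} → InΔ δ M → OΓ.Orb M N → f M ≡ f N
  f-orb {M} {N} m o = pair-cong (OΓ.χ-congˡ {M} {N} (Δ-nz m) o) V

  χΓ-inv : ∀ M → InΔ δ M → ∀ g → InΓ g → ∀ N → OΓ.χ M (g · N) ≡ OΓ.χ M N
  χΓ-inv M m g e N = sym (OΓ.χ-congʳ {M} {N} {g · N} (Δ-nz m) (g , e , refl))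

  -- f(M) - f(MS⁻¹) is the coefficient of V(1 - S) at the class of M in ℚ[Γ∖Δ]. There V(1 - S)
  -- agrees with x = (1 - S)ξ, because 1 - T acts as 0, and x vanishes because 1 - S does too.
  f-adjS : ∀ M → InΔ δ M → f (M · adj Sm) ≡ f M
  f-adjS M m = sym (p-q≡0⇒p≡q (begin
    f M ℚ.- f (M · adj Sm) ≡⟨ pair-χ-⊗1-S {Γ} M (Δ-nz m) V ⟨
    pair ψ y ≡⟨ ℚ.+-identityʳ (pair ψ y) ⟨
    pair ψ y ℚ.+ 0ℚ ≡⟨ cong (pair ψ y ℚ.+_) (pair-invariant {ψ} {Tm} η (χΓ-inv M m Tm refl)) ⟨
    pair ψ y ℚ.+ pair (∂ ψ) η ≡⟨ proj₂ (proj₂ decomposition) ψ (OΓ.χ-even {M} (Δ-nz m)) ⟨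
    pair ψ x ≡⟨ pair-1- ψ Sm ξ ⟩
    pair (λ N → ψ N ℚ.- ψ (Sm · N)) ξ ≡⟨ pair-invariant {ψ} {Sm} ξ (χΓ-inv M m Sm refl) ⟩
    0ℚ ∎))
    where
    open ≡-Reasoning
    ψ = OΓ.χ M
    η = proj₁ decomposition

  -- f depends only on the Γ-orbit, so M may be replaced by its representative N. Both N and NT fix
  -- ∞, where f equals X, and `X-T` applies.
  f-T : ∀ M → InΔ δ M → f (M · Tm) ≡ f M
  f-T M m with rep-of M m
  ... | i , o = begin
    f (M · Tm) ≡⟨ f-orb {N · Tm} {M · Tm} N·T∈Δ (OΓ.orb-·ʳ {N} {M} Tm o) ⟨
    f (N · Tm) ≡⟨ pair-∞ Between-Γ (N · Tm) N·T∈Δ (c-· {N} {Tm} (rep-c i) refl) ⟩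
    X (N · Tm) ≡⟨ X-T N (Δ-nz (rep∈Δ i)) (rep-c i) ⟩
    X N ≡⟨ pair-∞ Between-Γ N (rep∈Δ i) (rep-c i) ⟨
    f N ≡⟨ f-orb {N} {M} (rep∈Δ i) o ⟩
    f M ∎
    where
    open ≡-Reasoning
    N = lookup L i
    N·T∈Δ : InΔ δ (N · Tm)
    N·T∈Δ = Δ-·ʳ {Tm} {N} refl (rep∈Δ i)

  f-Γ : ∀ g → InΓ g → ∀ M → InΔ δ M → f (M · g) ≡ f M
  f-Γ g e = proj₂ (Γ-generated P P-·
    -- Invariance is known for S⁻¹ and T; `invert` supplies S and T⁻¹.
    (refl , invert Sm refl f-adjS) (refl , f-T)
    (refl , invert (adj Tm) refl f-T) g e)
    where
    Fixes : Mat → Set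
    Fixes g = ∀ M → InΔ δ M → f (M · g) ≡ f M
    P : Mat → Set
    P g = InΓ g × Fixes g
    P-· : ∀ {g h} → P g → P h → P (g · h)
    P-· {g} {h} (e , p) (e′ , p′) = InΓ-· {g} {h} e e′ , λ M m →
      trans (cong f (sym (·-assoc M g h))) (trans (p′ (M · g) (Δ-·ʳ {g} {M} e m)) (p M m))
    invert : ∀ g → InΓ g → Fixes (adj g) → Fixes g
    invert g e p M m = trans (sym (p (M · g) (Δ-·ʳ {g} {M} e m))) (cong f (·-cancelʳ M {g} e))

  α : ℚ
  α = f δ

  -- In M = gδh the factor g does not change the Γ-orbit, and h is removed by `f-Γ`.
  f-constant : ∀ M → InΔ δ M → f M ≡ α
  f-constant M m with Δ-elim {M} m
  ... | g , h , e , e′ , p = trans (cong f (trans p (·-assoc g δ h)))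
    (trans (sym (f-orb {δ · h} {g · (δ · h)} (Δ-·ʳ {h} {δ} e′ Δ-self) (g , e , refl))) (f-Γ h e′ δ Δ-self))

  X-constant : ∀ M → InΔ δ M → Mat.c M ≡ + 0 → X M ≡ α
  X-constant M m z = trans (sym (pair-∞ Between-Γ M m z)) (f-constant M m)

  pair-V : ∀ φ → pair φ V ≡ α ℚ.* pair φ (Tinf L)
  pair-V φ = go L (proj₁ reps)
    where
    go : ∀ L → All (λ M → InΔ δ M × Mat.c M ≡ + 0) L → pair φ (weighted X L) ≡ α ℚ.* pair φ (Tinf L)
    go [] [] = sym (ℚ.*-zeroʳ α)
    go (M ∷ L) ((m , z) ∷ ms) = trans (cong₂ (λ s t → s ℚ.* φ M ℚ.+ t) (X-constant M m z) (go L ms))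
      (solve 3 (λ a p t → a :* p :+ a :* t := a :* (con 1ℚ :* p :+ t)) refl α (φ M) (pair φ (Tinf L)))

  pair-rhs : ∀ φ β η → pair φ (β ⊙ (Tinf L ⊗ (one ⊖ [ Sm ])) ⊕ (one ⊖ [ Tm ]) ⊗ η) ≡
    β ℚ.* (pair φ (Tinf L) ℚ.- pair (λ N → φ (N · Sm)) (Tinf L)) ℚ.+ pair (∂ φ) η
  pair-rhs φ β η = trans (pair-++ φ (β ⊙ (Tinf L ⊗ (one ⊖ [ Sm ]))) ((one ⊖ [ Tm ]) ⊗ η))
    (cong₂ ℚ._+_ (trans (pair-⊙ φ β (Tinf L ⊗ (one ⊖ [ Sm ]))) (cong (β ℚ.*_) (pair--1 φ (Tinf L) Sm))) (pair-1- φ Tm η))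

  existence : CongModΔ δ x (α ⊙ (Tinf L ⊗ (one ⊖ [ Sm ])))
  existence = η , AllΔ⇒InRΔ η a , ≈-pair {x} {α ⊙ (Tinf L ⊗ (one ⊖ [ Sm ])) ⊕ (one ⊖ [ Tm ]) ⊗ η} λ φ ev →
    trans (h φ ev) (trans (cong (ℚ._+ pair (∂ φ) η) (trans (pair--1 φ V Sm)
      (trans (cong₂ ℚ._-_ (pair-V φ) (pair-V (λ N → φ (N · Sm))))
        (solve 3 (λ a p t → a :* p :- a :* t := a :* (p :- t)) refl α (pair φ (Tinf L)) (pair (λ N → φ (N · Sm)) (Tinf L))))))
      (sym (pair-rhs φ α η)))
    where
    η = proj₁ decomposition
    a = proj₁ (proj₂ decomposition)
    h = proj₂ (proj₂ decomposition)

  -- Both sides are paired with `χ N` for one representative N. The term (1 - T)η disappears, T_Δ^∞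
  -- gives 1, and T_Δ^∞S gives 0 because NS⁻¹ has lower-left entry -d ≠ 0. What remains is X(N) = β,
  -- and X(N) = α.
  uniqueness : ∀ β → CongModΔ δ x (β ⊙ (Tinf L ⊗ (one ⊖ [ Sm ]))) → β ≡ α
  uniqueness β (η , _ , e) = sym (begin
    α ≡⟨ X-constant N (rep∈Δ i) (rep-c i) ⟨
    pair (χ N) x ≡⟨ pair-≈ {χ N} (O∞.χ-even {N} nz) {x} {β ⊙ (Tinf L ⊗ (one ⊖ [ Sm ])) ⊕ (one ⊖ [ Tm ]) ⊗ η} e ⟩
    pair (χ N) (β ⊙ (Tinf L ⊗ (one ⊖ [ Sm ])) ⊕ (one ⊖ [ Tm ]) ⊗ η) ≡⟨ pair-rhs (χ N) β η ⟩
    β ℚ.* (pair (χ N) (Tinf L) ℚ.- pair (λ K → χ N (K · Sm)) (Tinf L)) ℚ.+ pair (∂ (χ N)) η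
      ≡⟨ cong₂ (λ s t → β ℚ.* s ℚ.+ t) (cong₂ ℚ._-_ at-N at-N·S) (pair-invariant {χ N} {Tm} η (χ-T N nz)) ⟩
    β ℚ.* (1ℚ ℚ.- 0ℚ) ℚ.+ 0ℚ ≡⟨ solve 1 (λ b → b :* (con 1ℚ :- con 0ℚ) :+ con 0ℚ := b) refl β ⟩
    β ∎)
    where
    open ≡-Reasoning
    i = proj₁ (rep-of δ Δ-self)
    N = lookup L i
    nz : det N ≢ + 0
    nz = Δ-nz (rep∈Δ i)
    at-N : pair (χ N) (Tinf L) ≡ 1ℚ
    -- `Tinf L` is `weighted` with constant weight 1.
    at-N = pair-rep Between-Γ∞ (λ _ → 1ℚ) i N (O∞.orb-refl N)
    at-N·S : pair (λ K → χ N (K · Sm)) (Tinf L) ≡ 0ℚ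
    at-N·S = trans (pair-cong (λ K → O∞.χ-·ʳ {N} {Sm} K nz refl) (Tinf L))
      (pair-off-∞ (λ _ → 1ℚ) (N · adj Sm) (-≢0 (d≢0 {N} nz (rep-c i)) ∘ trans (sym (c-adjS N))))

theorem2 : (δ : Mat) → + 0 ℤ.< det δ → (L : List Mat) → IsInftyReps δ L →
    (ξ : R) → InAΔ δ ξ →
    Σ ℚ (λ α → CongModΔ δ ((one ⊖ [ Sm ]) ⊗ ξ) (α ⊙ (Tinf L ⊗ (one ⊖ [ Sm ])))
    × (∀ β → CongModΔ δ ((one ⊖ [ Sm ]) ⊗ ξ) (β ⊙ (Tinf L ⊗ (one ⊖ [ Sm ]))) → β ≡ α))
theorem2 δ detδ>0 L reps ξ ξ∈AΔ = α , existence , uniqueness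
  where open Proof δ detδ>0 L reps ξ ξ∈AΔ
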